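{- In IITT: (1) If $\Delta\vdash t:T$, $\Delta\vdash t':T$ and $\Delta\vdash t\Longleftrightarrow_{\mathsf{tm}}t':T$, then $\Delta\vdash t=t':T$. (2) If $\Delta\vdash n:T$, $\Delta\vdash n':T$ and $\Delta\vdash n\Longleftrightarrow_{\mathsf{ne}}n':U$, then $\Delta\vdash n=n':U$ and $\Delta\vdash U=T$.
   Context: Irrelevant Intensional Type Theory (IITT) is defined as follows. Sorts are $\mathsf{Set}_k$ ($k\in\mathbb{N}$), with $\mathsf{Axiom}=\{(\mathsf{Set}_i,\mathsf{Set}_{i+1})\}$ and $\mathsf{Rule}=\{(\mathsf{Set}_i,\mathsf{Set}_j,\mathsf{Set}_{\max(i,j)})\}$. Annotations $\star\in\{:,\div\}$ (relevant, irrelevant). Expressions: $t,u,T,U ::= s \mid (x\star U)\to^{s,s'}T \mid x \mid \lambda x\star U.\,t \mid t\star u$ (relevant/irrelevant dependent function types annotated with domain sort $s$ and codomain sort $s'$; abstractions; relevant application $t\,u$ and irrelevant application $t\div u$), modulo $\alpha$-equivalence; $[u/x]t$ is substitution. Contexts $\Gamma ::= ()\mid\Gamma.x\star T$. Resurrection $\Gamma^\oplus$ turns every $x\div T$ into $x:T$. Abbreviations: $\Gamma\vdash t\div T$ means $\Gamma^\oplus\vdash t:T$; $\Gamma\vdash t=t'\div T$ means $\Gamma\vdash t\div T$ and $\Gamma\vdash t'\div T$; $\Gamma\vdash T$ means $\Gamma\vdash T:s$ for some sort $s$; $\Gamma\vdash T=T'$ means $\Gamma\vdash T=T':s$ for some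 $s$. Rules: $\vdash()$; from $\vdash\Gamma$, $\Gamma\vdash T$ infer $\vdash\Gamma.x\star T$; from $\vdash\Gamma$, $(s,s')\in\mathsf{Axiom}$ infer $\Gamma\vdash s:s'$; from $\Gamma\vdash U:s_1$, $\Gamma.x\star U\vdash T:s_2$, $(s_1,s_2,s_3)\in\mathsf{Rule}$ infer $\Gamma\vdash(x\star U)\to^{s_1,s_2}T:s_3$; from $\vdash\Gamma$, $(x:U)\in\Gamma$ infer $\Gamma\vdash x:U$; from $\Gamma.x\star U\vdash t:T$, $\Gamma\vdash(x\star U)\to^{s,s'}T$ infer $\Gamma\vdash\lambda x\star U.t:(x\star U)\to^{s,s'}T$; from $\Gamma\vdash t:(x\star U)\to^{s,s'}T$, $\Gamma\vdash u\star U$ infer $\Gamma\vdash t\star u:[u/x]T$; from $\Gamma\vdash t:T$, $\Gamma\vdash T=T'$ infer $\Gamma\vdash t:T'$; $\beta$: from $\Gamma.x\star U\vdash t:T$, $\Gamma\vdash u\star U$ infer $\Gamma\vdash(\lambda x\star U.t)\star u=[u/x]t:[u/x]T$; $\eta$: from $\Gamma\vdash t:(x\star U)\to^{s,s'}T$ infer $\Gamma\vdash t=\lambda x\star U.(t\star x):(x\star U)\to^{s,s'}T$; reflexivity, symmetry, transitivity; congruence for function types (from $\Gamma\vdash U=U':s_1$, $\Gamma.x\star U\vdash T=T':s_2$, $(s_1,s_2,s_3)\in\mathsf{Rule}$), for abstractions (from $\Gamma\vdash U=U':s_1$, $\Gamma.x\star U\vdash T:s_2$, $\Gamma.x\star U\vdash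 t=t':T$ infer $\Gamma\vdash\lambda x\star U.t=\lambda x\star U'.t':(x\star U)\to^{s_1,s_2}T$), for application (from $\Gamma\vdash t=t':(x\star U)\to^{s,s'}T$ and $\Gamma\vdash u=u'\star U$ infer $\Gamma\vdash t\star u=t'\star u':[u/x]T$); conversion: from $\Gamma\vdash t=t':T$, $\Gamma\vdash T=T'$ infer $\Gamma\vdash t=t':T'$. Weak head normal forms $a,A ::= s\mid(x\star U)\to^{s,s'}T\mid\lambda x\star U.t\mid n$; neutrals $n,N ::= x\mid n\star u$. Weak head evaluation: $a\searrow a$ for whnf $a$; if $t\searrow f$ and $f\,@^\star u\searrow a$ then $t\star u\searrow a$; if $[u/x]t\searrow a$ then $(\lambda x\star U.t)\,@^\star u\searrow a$; $n\,@^\star u\searrow n\star u$. Algorithmic equality (mutually inductive; long arrows on whnf types): Type equality: $\Delta\vdash T\Longleftrightarrow_{\mathsf{ty}}T'$ if $T\searrow A$, $T'\searrow A'$, $\Delta\vdash A\longleftrightarrow_{\mathsf{ty}}A'$; $\Delta\vdash s\longleftrightarrow_{\mathsf{ty}}s$; $\Delta\vdash(x\star U)\to^{s,s'}T\longleftrightarrow_{\mathsf{ty}}(x\star U')\to^{s,s'}T'$ if $\Delta\vdash U\Longleftrightarrow_{\mathsf{ty}}U'$ and $\Delta.x\star U\vdash T\Longleftrightarrow_{\mathsf{ty}}T'$; $\Delta\vdash N\longleftrightarrow_{\mathsf{ty}}N'$ for neutrals if $\Delta\vdash N\Longleftrightarrow_{\mathsf{ne}}N':T$ for some $T$. Structural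 equality (type is output): $\Delta\vdash x\Longleftrightarrow_{\mathsf{ne}}x:T$ if $(x:T)\in\Delta$; $\Delta\vdash n\,u\Longleftrightarrow_{\mathsf{ne}}n'\,u':[u/x]T$ if $\Delta\vdash n\longleftrightarrow_{\mathsf{ne}}n':(x:U)\to^{s,s'}T$ and $\Delta\vdash u\Longleftrightarrow_{\mathsf{tm}}u':U$; $\Delta\vdash n\div u\Longleftrightarrow_{\mathsf{ne}}n'\div u':[u/x]T$ if $\Delta\vdash n\longleftrightarrow_{\mathsf{ne}}n':(x\div U)\to^{s,s'}T$; $\Delta\vdash n\longleftrightarrow_{\mathsf{ne}}n':A$ if $\Delta\vdash n\Longleftrightarrow_{\mathsf{ne}}n':T$ and $T\searrow A$. Type-directed equality: $\Delta\vdash t\Longleftrightarrow_{\mathsf{tm}}t':T$ if $T\searrow A$ and $\Delta\vdash t\longleftrightarrow_{\mathsf{tm}}t':A$; $\Delta\vdash t\longleftrightarrow_{\mathsf{tm}}t':(x\star U)\to^{s,s'}T$ if $\Delta.x\star U\vdash t\star x\Longleftrightarrow_{\mathsf{tm}}t'\star x:T$; $\Delta\vdash T\longleftrightarrow_{\mathsf{tm}}T':s$ if $\Delta\vdash T\Longleftrightarrow_{\mathsf{ty}}T'$; $\Delta\vdash t\longleftrightarrow_{\mathsf{tm}}t':N$ for neutral $N$ if $t\searrow n$, $t'\searrow n'$, and $\Delta\vdash n\Longleftrightarrow_{\mathsf{ne}}n':T$ for some $T$. -}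

module Defs where

open import Data.Nat using (ℕ; zero; suc; _⊔_)
open import Data.Product using (Σ; _×_; _,_)

data Ann : Set where
  rel : Ann
  irr : Ann

data Tm : Set where
  sort : ℕ → Tm
  Π    : Ann → Tm → ℕ → ℕ → Tm → Tm     -- Π ⋆ U s s' T  =  (x ⋆ U) →^{Set_s , Set_s'} T   (T binds x)
  var  : ℕ → Tm
  lam  : Ann → Tm → Tm → Tm
  app  : Ann → Tm → Tm → Tm

liftRen : (ℕ → ℕ) → ℕ → ℕ
liftRen ρ zero    = zero
liftRen ρ (suc n) = suc (ρ n)

ren : (ℕ → ℕ) → Tm → Tm
ren ρ (sort k)       = sort k
ren ρ (Π a U s s' T) = Π a (ren ρ U) s s' (ren (liftRen ρ) T)
ren ρ (var n)        = var (ρ n)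
ren ρ (lam a U t)    = lam a (ren ρ U) (ren (liftRen ρ) t)
ren ρ (app a t u)    = app a (ren ρ t) (ren ρ u)

wk : Tm → Tm
wk = ren suc

liftSub : (ℕ → Tm) → ℕ → Tm
liftSub σ zero    = var zero
liftSub σ (suc n) = wk (σ n)

sub : (ℕ → Tm) → Tm → Tm
sub σ (sort k)       = sort k
sub σ (Π a U s s' T) = Π a (sub σ U) s s' (sub (liftSub σ) T)
sub σ (var n)        = σ n
sub σ (lam a U t)    = lam a (sub σ U) (sub (liftSub σ) t)
sub σ (app a t u)    = app a (sub σ t) (sub σ u)

single : Tm → ℕ → Tm
single u zero    = u
single u (suc n) = var n

_[_] : Tm → Tm → Tm
t [ u ] = sub (single u) t

data Ctx : Set where
  ε     : Ctx
  _▸_∶_ : Ctx → Ann → Tm → Ctx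

_⊕ : Ctx → Ctx
ε ⊕           = ε
(Γ ▸ a ∶ T) ⊕ = (Γ ⊕) ▸ rel ∶ T

data _∋_∶_ : Ctx → ℕ → Tm → Set where
  here  : ∀ {Γ T} → (Γ ▸ rel ∶ T) ∋ zero ∶ wk T
  there : ∀ {Γ a U x T} → Γ ∋ x ∶ T → (Γ ▸ a ∶ U) ∋ suc x ∶ wk T

infix 4 ⊢_ _⊢_∶_ _⊢_≡_∶_ _⊢_∶[_]_ _⊢_≡_∶[_]_

mutual
  data ⊢_ : Ctx → Set where
    ⊢ε : ⊢ ε
    ⊢▸ : ∀ {Γ a T} → ⊢ Γ → Σ ℕ (λ k → Γ ⊢ T ∶ sort k) → ⊢ (Γ ▸ a ∶ T)

  data _⊢_∶_ : Ctx → Tm → Tm → Set where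
    ty-sort : ∀ {Γ i} → ⊢ Γ → Γ ⊢ sort i ∶ sort (suc i)
    ty-Π    : ∀ {Γ a U T i j} → Γ ⊢ U ∶ sort i → (Γ ▸ a ∶ U) ⊢ T ∶ sort j →
              Γ ⊢ Π a U i j T ∶ sort (i ⊔ j)
    ty-var  : ∀ {Γ x U} → ⊢ Γ → Γ ∋ x ∶ U → Γ ⊢ var x ∶ U
    ty-lam  : ∀ {Γ a U t T s s'} → (Γ ▸ a ∶ U) ⊢ t ∶ T →
              Σ ℕ (λ k → Γ ⊢ Π a U s s' T ∶ sort k) →
              Γ ⊢ lam a U t ∶ Π a U s s' T
    ty-app  : ∀ {Γ a t u U T s s'} → Γ ⊢ t ∶ Π a U s s' T → Γ ⊢ u ∶[ a ] U →
              Γ ⊢ app a t u ∶ T [ u ]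
    ty-conv : ∀ {Γ t T T'} → Γ ⊢ t ∶ T → Σ ℕ (λ k → Γ ⊢ T ≡ T' ∶ sort k) →
              Γ ⊢ t ∶ T'

  data _⊢_∶[_]_ : Ctx → Tm → Ann → Tm → Set where
    ann-rel : ∀ {Γ u U} → Γ ⊢ u ∶ U → Γ ⊢ u ∶[ rel ] U
    ann-irr : ∀ {Γ u U} → (Γ ⊕) ⊢ u ∶ U → Γ ⊢ u ∶[ irr ] U

  data _⊢_≡_∶[_]_ : Ctx → Tm → Tm → Ann → Tm → Set where
    eqann-rel : ∀ {Γ u u' U} → Γ ⊢ u ≡ u' ∶ U → Γ ⊢ u ≡ u' ∶[ rel ] U
    eqann-irr : ∀ {Γ u u' U} → (Γ ⊕) ⊢ u ∶ U → (Γ ⊕) ⊢ u' ∶ U → Γ ⊢ u ≡ u' ∶[ irr ] U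

  data _⊢_≡_∶_ : Ctx → Tm → Tm → Tm → Set where
    eq-β     : ∀ {Γ a U t T u} → (Γ ▸ a ∶ U) ⊢ t ∶ T → Γ ⊢ u ∶[ a ] U →
               Γ ⊢ app a (lam a U t) u ≡ t [ u ] ∶ T [ u ]
    eq-η     : ∀ {Γ a U T s s' t} → Γ ⊢ t ∶ Π a U s s' T →
               Γ ⊢ t ≡ lam a U (app a (wk t) (var zero)) ∶ Π a U s s' T
    eq-refl  : ∀ {Γ t T} → Γ ⊢ t ∶ T → Γ ⊢ t ≡ t ∶ T
    eq-sym   : ∀ {Γ t t' T} → Γ ⊢ t ≡ t' ∶ T → Γ ⊢ t' ≡ t ∶ T
    eq-trans : ∀ {Γ t t' t'' T} → Γ ⊢ t ≡ t' ∶ T → Γ ⊢ t' ≡ t'' ∶ T → Γ ⊢ t ≡ t'' ∶ T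
    eq-Π     : ∀ {Γ a U U' T T' i j} → Γ ⊢ U ≡ U' ∶ sort i → (Γ ▸ a ∶ U) ⊢ T ≡ T' ∶ sort j →
               Γ ⊢ Π a U i j T ≡ Π a U' i j T' ∶ sort (i ⊔ j)
    eq-lam   : ∀ {Γ a U U' T t t' i j} → Γ ⊢ U ≡ U' ∶ sort i → (Γ ▸ a ∶ U) ⊢ T ∶ sort j →
               (Γ ▸ a ∶ U) ⊢ t ≡ t' ∶ T →
               Γ ⊢ lam a U t ≡ lam a U' t' ∶ Π a U i j T
    eq-app   : ∀ {Γ a t t' u u' U T s s'} → Γ ⊢ t ≡ t' ∶ Π a U s s' T → Γ ⊢ u ≡ u' ∶[ a ] U →
               Γ ⊢ app a t u ≡ app a t' u' ∶ T [ u ]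
    eq-conv  : ∀ {Γ t t' T T'} → Γ ⊢ t ≡ t' ∶ T → Σ ℕ (λ k → Γ ⊢ T ≡ T' ∶ sort k) →
               Γ ⊢ t ≡ t' ∶ T'

_⊢_≡ty_ : Ctx → Tm → Tm → Set
Γ ⊢ T ≡ty T' = Σ ℕ (λ k → Γ ⊢ T ≡ T' ∶ sort k)

data Neutral : Tm → Set where
  ne-var : ∀ {x} → Neutral (var x)
  ne-app : ∀ {a n u} → Neutral n → Neutral (app a n u)

data Whnf : Tm → Set where
  wh-sort : ∀ {k} → Whnf (sort k)
  wh-Π    : ∀ {a U s s' T} → Whnf (Π a U s s' T)
  wh-lam  : ∀ {a U t} → Whnf (lam a U t)
  wh-ne   : ∀ {n} → Neutral n → Whnf n

infix 4 _↘_ _·[_]_↘_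

mutual
  data _↘_ : Tm → Tm → Set where
    ev-whnf : ∀ {a} → Whnf a → a ↘ a
    ev-app  : ∀ {b t u f r} → t ↘ f → f ·[ b ] u ↘ r → app b t u ↘ r

  data _·[_]_↘_ : Tm → Ann → Tm → Tm → Set where
    ap-β  : ∀ {b U t u r} → t [ u ] ↘ r → lam b U t ·[ b ] u ↘ r
    ap-ne : ∀ {b n u} → Neutral n → n ·[ b ] u ↘ app b n u

infix 4 _⊢_⇔ty_ _⊢_↔ty_ _⊢_⇔ne_∶_ _⊢_↔ne_∶_ _⊢_⇔tm_∶_ _⊢_↔tm_∶_

mutual
  data _⊢_⇔ty_ : Ctx → Tm → Tm → Set where
    ty-alg : ∀ {Δ T T' A A'} → T ↘ A → T' ↘ A' → Δ ⊢ A ↔ty A' → Δ ⊢ T ⇔ty T'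

  data _⊢_↔ty_ : Ctx → Tm → Tm → Set where
    tyw-sort : ∀ {Δ k} → Δ ⊢ sort k ↔ty sort k
    tyw-Π    : ∀ {Δ a U U' s s' T T'} → Δ ⊢ U ⇔ty U' → (Δ ▸ a ∶ U) ⊢ T ⇔ty T' →
               Δ ⊢ Π a U s s' T ↔ty Π a U' s s' T'
    tyw-ne   : ∀ {Δ N N' T} → Neutral N → Neutral N' → Δ ⊢ N ⇔ne N' ∶ T → Δ ⊢ N ↔ty N'

  data _⊢_⇔ne_∶_ : Ctx → Tm → Tm → Tm → Set where
    ne-var   : ∀ {Δ x T} → Δ ∋ x ∶ T → Δ ⊢ var x ⇔ne var x ∶ T
    ne-apprel : ∀ {Δ n n' u u' U s s' T} → Δ ⊢ n ↔ne n' ∶ Π rel U s s' T → Δ ⊢ u ⇔tm u' ∶ U →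
                Δ ⊢ app rel n u ⇔ne app rel n' u' ∶ T [ u ]
    ne-appirr : ∀ {Δ n n' u u' U s s' T} → Δ ⊢ n ↔ne n' ∶ Π irr U s s' T →
                Δ ⊢ app irr n u ⇔ne app irr n' u' ∶ T [ u ]

  data _⊢_↔ne_∶_ : Ctx → Tm → Tm → Tm → Set where
    new : ∀ {Δ n n' T A} → Δ ⊢ n ⇔ne n' ∶ T → T ↘ A → Δ ⊢ n ↔ne n' ∶ A

  data _⊢_⇔tm_∶_ : Ctx → Tm → Tm → Tm → Set where
    tm-alg : ∀ {Δ t t' T A} → T ↘ A → Δ ⊢ t ↔tm t' ∶ A → Δ ⊢ t ⇔tm t' ∶ T

  data _⊢_↔tm_∶_ : Ctx → Tm → Tm → Tm → Set where
    tmw-Π    : ∀ {Δ a U s s' T t t'} →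
               (Δ ▸ a ∶ U) ⊢ app a (wk t) (var zero) ⇔tm app a (wk t') (var zero) ∶ T →
               Δ ⊢ t ↔tm t' ∶ Π a U s s' T
    tmw-sort : ∀ {Δ k T T'} → Δ ⊢ T ⇔ty T' → Δ ⊢ T ↔tm T' ∶ sort k
    tmw-ne   : ∀ {Δ N t t' n n' T} → Neutral N → t ↘ n → t' ↘ n' →
               Neutral n → Neutral n' → Δ ⊢ n ⇔ne n' ∶ T → Δ ⊢ t ↔tm t' ∶ N

module Submission where

-- Soundness needs injectivity of Π for declarative equality (hence subject reduction) and
-- uniqueness of sorts.  Both are read off a Kripke logical relation: every type is related to
-- itself at its weak head normal form, and since evaluation is deterministic, equal Π types have
-- related, in particular declaratively equal, domains and codomains.  At neutral types the
-- relation on terms is declarative equality itself, so no completeness of the algorithm is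
-- needed, and irrelevant arguments are only required to be well typed after resurrection.
--
-- The relation is built over a presentation of the declarative system with a single judgement
-- Γ ⊢ t ≈ t' ∶ T, typing being its diagonal, whose redundant premises make substitution,
-- functionality and validity provable by plain induction.

open import Defs
open import Data.Nat using (ℕ; zero; suc; _⊔_; _<′_; _≤′_; ≤′-step; <′-base)
open import Data.Nat.Induction using (<′-wellFounded)
open import Data.Nat.Properties using (≤′-trans; m≤m⊔n; m≤n⊔m; ≤⇒≤′)
open import Data.Product using (Σ; ∃; _×_; _,_; proj₁; proj₂)
open import Function using (_∘_; id)
open import Induction.WellFounded using (Acc; acc)
open import Relation.Binary.Construct.Closure.ReflexiveTransitive
  using (Star; _◅_; _◅◅_; gmap; reverse) renaming (ε to [])
open import Relation.Binary.PropositionalEquality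
  using (refl; sym; trans; cong; cong₂; subst; subst₂) renaming (_≡_ to _≐_)

-- Substitution calculus

-- The algorithm compares arguments of neutrals at the domain it has computed itself, while
-- inversion of typing yields arguments at the domains of other Π types that are merely convertible
-- to that one; injectivity is what moves the arguments across. Uniqueness of sorts enters because
-- the conclusion asks for a type equality at one sort, whereas inversion yields a chain of
-- conversions whose links may live at different sorts.
--
-- The obstacle specific to irrelevance is that an irrelevant variable is not a term of `Γ`, yet it
-- may occur inside irrelevant arguments, which are checked in `Γ ⊕`. Renamings and substitutions
-- therefore also carry data about resurrected contexts. In the fundamental lemma the images of
-- irrelevant variables can stay unrelated: variable lookup never reaches them, and irrelevant
-- arguments are treated by declarative substitution alone.

infixr 5 _∙_

_∙_ : Tm → (ℕ → Tm) → ℕ → Tm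
(u ∙ σ) zero    = u
(u ∙ σ) (suc n) = σ n

ren-cong : ∀ {ρ ρ'} → (∀ x → ρ x ≐ ρ' x) → ∀ t → ren ρ t ≐ ren ρ' t
ren-cong e (sort k)       = refl
ren-cong e (Π a U i j T)  = cong₂ (λ U T → Π a U i j T) (ren-cong e U)
  (ren-cong (λ { zero → refl ; (suc x) → cong suc (e x) }) T)
ren-cong e (var x)        = cong var (e x)
ren-cong e (lam a U t)    = cong₂ (lam a) (ren-cong e U)
  (ren-cong (λ { zero → refl ; (suc x) → cong suc (e x) }) t)
ren-cong e (app a t u)    = cong₂ (app a) (ren-cong e t) (ren-cong e u)

sub-cong : ∀ {σ σ'} → (∀ x → σ x ≐ σ' x) → ∀ t → sub σ t ≐ sub σ' t
sub-cong e (sort k)       = refl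
sub-cong e (Π a U i j T)  = cong₂ (λ U T → Π a U i j T) (sub-cong e U)
  (sub-cong (λ { zero → refl ; (suc x) → cong wk (e x) }) T)
sub-cong e (var x)        = e x
sub-cong e (lam a U t)    = cong₂ (lam a) (sub-cong e U)
  (sub-cong (λ { zero → refl ; (suc x) → cong wk (e x) }) t)
sub-cong e (app a t u)    = cong₂ (app a) (sub-cong e t) (sub-cong e u)

ren-is-sub : ∀ {ρ} t → ren ρ t ≐ sub (var ∘ ρ) t
ren-is-sub (sort k)       = refl
ren-is-sub (Π a U i j T)  = cong₂ (λ U T → Π a U i j T) (ren-is-sub U)
  (trans (ren-is-sub T) (sub-cong (λ { zero → refl ; (suc x) → refl }) T))
ren-is-sub (var x)        = refl
ren-is-sub (lam a U t)    = cong₂ (lam a) (ren-is-sub U)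
  (trans (ren-is-sub t) (sub-cong (λ { zero → refl ; (suc x) → refl }) t))
ren-is-sub (app a t u)    = cong₂ (app a) (ren-is-sub t) (ren-is-sub u)

sub-ren : ∀ {σ ρ} t → sub σ (ren ρ t) ≐ sub (σ ∘ ρ) t
sub-ren (sort k)      = refl
sub-ren (Π a U i j T) = cong₂ (λ U T → Π a U i j T) (sub-ren U)
  (trans (sub-ren T) (sub-cong (λ { zero → refl ; (suc x) → refl }) T))
sub-ren (var x)       = refl
sub-ren (lam a U t)   = cong₂ (lam a) (sub-ren U)
  (trans (sub-ren t) (sub-cong (λ { zero → refl ; (suc x) → refl }) t))
sub-ren (app a t u)   = cong₂ (app a) (sub-ren t) (sub-ren u)

ren-ren : ∀ {ρ' ρ} t → ren ρ' (ren ρ t) ≐ ren (ρ' ∘ ρ) t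
ren-ren {ρ'} {ρ} t =
  trans (ren-is-sub (ren ρ t)) (trans (sub-ren t) (sym (ren-is-sub t)))

ren-wk : ∀ {ρ} t → ren (liftRen ρ) (wk t) ≐ wk (ren ρ t)
ren-wk t = trans (ren-ren t) (sym (ren-ren t))

ren-sub : ∀ {ρ σ} t → ren ρ (sub σ t) ≐ sub (ren ρ ∘ σ) t
ren-sub (sort k)      = refl
ren-sub {ρ} {σ} (Π a U i j T) = cong₂ (λ U T → Π a U i j T) (ren-sub U)
  (trans (ren-sub T) (sub-cong (λ { zero → refl ; (suc x) → ren-wk (σ x) }) T))
ren-sub (var x)       = refl
ren-sub {ρ} {σ} (lam a U t) = cong₂ (lam a) (ren-sub U)
  (trans (ren-sub t) (sub-cong (λ { zero → refl ; (suc x) → ren-wk (σ x) }) t))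
ren-sub (app a t u)   = cong₂ (app a) (ren-sub t) (ren-sub u)

sub-wk : ∀ {σ} t → sub (liftSub σ) (wk t) ≐ wk (sub σ t)
sub-wk t = trans (sub-ren t) (sym (ren-sub t))

sub-sub : ∀ {τ σ} t → sub τ (sub σ t) ≐ sub (sub τ ∘ σ) t
sub-sub (sort k)      = refl
sub-sub {τ} {σ} (Π a U i j T) = cong₂ (λ U T → Π a U i j T) (sub-sub U)
  (trans (sub-sub T) (sub-cong (λ { zero → refl ; (suc x) → sub-wk (σ x) }) T))
sub-sub (var x)       = refl
sub-sub {τ} {σ} (lam a U t) = cong₂ (lam a) (sub-sub U)
  (trans (sub-sub t) (sub-cong (λ { zero → refl ; (suc x) → sub-wk (σ x) }) t))
sub-sub (app a t u)   = cong₂ (app a) (sub-sub t) (sub-sub u)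

sub-var : ∀ t → sub var t ≐ t
sub-var (sort k)      = refl
sub-var (Π a U i j T) = cong₂ (λ U T → Π a U i j T) (sub-var U)
  (trans (sub-cong (λ { zero → refl ; (suc x) → refl }) T) (sub-var T))
sub-var (var x)       = refl
sub-var (lam a U t)   = cong₂ (lam a) (sub-var U)
  (trans (sub-cong (λ { zero → refl ; (suc x) → refl }) t) (sub-var t))
sub-var (app a t u)   = cong₂ (app a) (sub-var t) (sub-var u)

ren-id : ∀ t → ren id t ≐ t
ren-id t = trans (ren-is-sub t) (sub-var t)

ren-lift-id : ∀ t → ren (liftRen id) t ≐ t
ren-lift-id t = trans (ren-cong (λ { zero → refl ; (suc x) → refl }) t) (ren-id t)

sub-[] : ∀ {σ} t {u} → sub σ (t [ u ]) ≐ sub (liftSub σ) t [ sub σ u ]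
sub-[] {σ} t {u} = trans (sub-sub t) (trans
  (sub-cong (λ { zero → refl ; (suc x) → sym (trans (sub-ren (σ x)) (sub-var (σ x))) }) t)
  (sym (sub-sub t)))

ren-[] : ∀ {ρ} t {u} → ren ρ (t [ u ]) ≐ ren (liftRen ρ) t [ ren ρ u ]
ren-[] t = trans (ren-sub t) (trans
  (sub-cong (λ { zero → refl ; (suc x) → refl }) t) (sym (sub-ren t)))

wk-[] : ∀ t {u} → wk t [ u ] ≐ t
wk-[] t = trans (sub-ren t) (sub-var t)

lift-[] : ∀ {σ} t {u} → sub (liftSub σ) t [ u ] ≐ sub (u ∙ σ) t
lift-[] {σ} t = trans (sub-sub t)
  (sub-cong (λ { zero → refl ; (suc x) → wk-[] (σ x) }) t)

-- The left side is the codomain instance as the Kripke clause for Π spells it; the right side is a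
-- single substitution by an extended environment, the shape that the induction hypotheses of the
-- fundamental lemma deliver.
ren-lift-[] : ∀ {ρ σ} t {u} →
  ren (liftRen ρ) (sub (liftSub σ) t) [ u ] ≐ sub (u ∙ (ren ρ ∘ σ)) t
ren-lift-[] {ρ} {σ} t = trans (cong (_[ _ ]) (trans (ren-sub t)
    (sub-cong {σ' = liftSub (ren ρ ∘ σ)} (λ { zero → refl ; (suc x) → ren-wk (σ x) }) t)))
  (lift-[] t)

lift-var0 : ∀ t → ren (liftRen suc) t [ var zero ] ≐ t
lift-var0 t = trans (sub-ren t)
  (trans (sub-cong (λ { zero → refl ; (suc x) → refl }) t) (sub-var t))

-- The one-judgement presentation: renaming and substitution

infix 4 _⊢_≈_∶_ _⊢_≈_∶[_]_

mutual
  data Wf : Ctx → Set where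
    wf-ε : Wf ε
    wf-▸ : ∀ {Γ a U k} → Wf Γ → Γ ⊢ U ≈ U ∶ sort k → Wf (Γ ▸ a ∶ U)

  data _⊢_≈_∶_ : Ctx → Tm → Tm → Tm → Set where
    ≈-sort  : ∀ {Γ i} → Wf Γ → Γ ⊢ sort i ≈ sort i ∶ sort (suc i)
    ≈-var   : ∀ {Γ x U} → Wf Γ → Γ ∋ x ∶ U → Γ ⊢ var x ≈ var x ∶ U
    ≈-Π     : ∀ {Γ a U U' T T' i j} → Γ ⊢ U ≈ U' ∶ sort i →
              (Γ ▸ a ∶ U) ⊢ T ≈ T' ∶ sort j → (Γ ▸ a ∶ U') ⊢ T' ≈ T' ∶ sort j →
              Γ ⊢ Π a U i j T ≈ Π a U' i j T' ∶ sort (i ⊔ j)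
    ≈-lam   : ∀ {Γ a U U' T t t' i j} → Γ ⊢ U ≈ U' ∶ sort i →
              (Γ ▸ a ∶ U) ⊢ T ≈ T ∶ sort j → (Γ ▸ a ∶ U) ⊢ t ≈ t' ∶ T →
              (Γ ▸ a ∶ U') ⊢ T ≈ T ∶ sort j → (Γ ▸ a ∶ U') ⊢ t' ≈ t' ∶ T →
              Γ ⊢ lam a U t ≈ lam a U' t' ∶ Π a U i j T
    ≈-app   : ∀ {Γ a t t' u u' U T i j} → Γ ⊢ U ≈ U ∶ sort i →
              (Γ ▸ a ∶ U) ⊢ T ≈ T ∶ sort j →
              Γ ⊢ t ≈ t' ∶ Π a U i j T → Γ ⊢ u ≈ u' ∶[ a ] U →
              Γ ⊢ T [ u ] ≈ T [ u' ] ∶ sort j →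
              Γ ⊢ app a t u ≈ app a t' u' ∶ T [ u ]
    ≈-β     : ∀ {Γ a U t T u i j} → Γ ⊢ U ≈ U ∶ sort i →
              (Γ ▸ a ∶ U) ⊢ T ≈ T ∶ sort j → (Γ ▸ a ∶ U) ⊢ t ≈ t ∶ T →
              Γ ⊢ u ≈ u ∶[ a ] U → Γ ⊢ t [ u ] ≈ t [ u ] ∶ T [ u ] →
              Γ ⊢ app a (lam a U t) u ≈ t [ u ] ∶ T [ u ]
    ≈-η     : ∀ {Γ a U T i j t} → Γ ⊢ U ≈ U ∶ sort i → (Γ ▸ a ∶ U) ⊢ T ≈ T ∶ sort j →
              Γ ⊢ t ≈ t ∶ Π a U i j T →
              Γ ⊢ lam a U (app a (wk t) (var zero)) ≈ lam a U (app a (wk t) (var zero))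
                ∶ Π a U i j T →
              Γ ⊢ t ≈ lam a U (app a (wk t) (var zero)) ∶ Π a U i j T
    ≈-sym   : ∀ {Γ t t' T k} → Γ ⊢ T ≈ T ∶ sort k → Γ ⊢ t ≈ t' ∶ T → Γ ⊢ t' ≈ t ∶ T
    ≈-trans : ∀ {Γ t t' t'' T} → Γ ⊢ t ≈ t' ∶ T → Γ ⊢ t' ≈ t'' ∶ T → Γ ⊢ t ≈ t'' ∶ T
    ≈-conv  : ∀ {Γ t t' T T' k} → Γ ⊢ t ≈ t' ∶ T → Γ ⊢ T ≈ T' ∶ sort k → Γ ⊢ t ≈ t' ∶ T'

  data _⊢_≈_∶[_]_ : Ctx → Tm → Tm → Ann → Tm → Set where
    ≈-rel : ∀ {Γ u u' U} → Γ ⊢ u ≈ u' ∶ U → Γ ⊢ u ≈ u' ∶[ rel ] U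
    ≈-irr : ∀ {Γ u u' U} → (Γ ⊕) ⊢ u ≈ u ∶ U → (Γ ⊕) ⊢ u' ≈ u' ∶ U → Γ ⊢ u ≈ u' ∶[ irr ] U

≈-wf : ∀ {Γ t t' T} → Γ ⊢ t ≈ t' ∶ T → Wf Γ
≈-wf (≈-sort w)        = w
≈-wf (≈-var w x)       = w
≈-wf (≈-Π d _ _)       = ≈-wf d
≈-wf (≈-lam d _ _ _ _) = ≈-wf d
≈-wf (≈-app d _ _ _ _) = ≈-wf d
≈-wf (≈-β d _ _ _ _)   = ≈-wf d
≈-wf (≈-η d _ _ _)     = ≈-wf d
≈-wf (≈-sym d _)       = ≈-wf d
≈-wf (≈-trans d _)     = ≈-wf d
≈-wf (≈-conv d _)      = ≈-wf d

≈-symᵗ : ∀ {Γ A B k} → Γ ⊢ A ≈ B ∶ sort k → Γ ⊢ B ≈ A ∶ sort k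
≈-symᵗ d = ≈-sym (≈-sort (≈-wf d)) d

≈-reflˡ : ∀ {Γ A B k} → Γ ⊢ A ≈ B ∶ sort k → Γ ⊢ A ≈ A ∶ sort k
≈-reflˡ d = ≈-trans d (≈-symᵗ d)

≈-reflʳ : ∀ {Γ A B k} → Γ ⊢ A ≈ B ∶ sort k → Γ ⊢ B ≈ B ∶ sort k
≈-reflʳ d = ≈-trans (≈-symᵗ d) d

∋-⊕ : ∀ {Γ x T} → Γ ∋ x ∶ T → (Γ ⊕) ∋ x ∶ T
∋-⊕ here      = here
∋-⊕ (there x) = there (∋-⊕ x)

⊕-idem : ∀ Γ → (Γ ⊕) ⊕ ≐ Γ ⊕
⊕-idem ε           = refl
⊕-idem (Γ ▸ a ∶ T) = cong (λ Γ → Γ ▸ rel ∶ T) (⊕-idem Γ)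

-- The resurrected half is carried along because `ren-≈` has to enter the premises of `≈-irr`, which
-- live in `Γ ⊕`, and because `Wf (Δ ⊕)` cannot yet be derived from `Wf Δ`: that derivation itself
-- goes through renaming.
record Ren (Δ : Ctx) (ρ : ℕ → ℕ) (Γ : Ctx) : Set where
  field
    wf   : Wf Δ
    wf⊕  : Wf (Δ ⊕)
    var∋ : ∀ {x T} → Γ ∋ x ∶ T → Δ ∋ ρ x ∶ ren ρ T
    var⊕ : ∀ {x T} → (Γ ⊕) ∋ x ∶ T → (Δ ⊕) ∋ ρ x ∶ ren ρ T

open Ren

-- Resurrecting only the target lets one derivation be renamed a second time, which types the domain
-- of a binder in `Δ ⊕` before `≈-⊕` is available.
Ren-⊕ˡ : ∀ {Δ ρ Γ} → Ren Δ ρ Γ → Ren (Δ ⊕) ρ Γ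
Ren-⊕ˡ {Δ} r .wf = wf⊕ r
Ren-⊕ˡ {Δ} r .wf⊕ = subst Wf (sym (⊕-idem Δ)) (wf⊕ r)
Ren-⊕ˡ {Δ} r .var∋ x = ∋-⊕ (var∋ r x)
Ren-⊕ˡ {Δ} r .var⊕ x = ∋-⊕ (var⊕ r x)

Ren-⊕ : ∀ {Δ ρ Γ} → Ren Δ ρ Γ → Ren (Δ ⊕) ρ (Γ ⊕)
Ren-⊕ r .wf = wf (Ren-⊕ˡ r)
Ren-⊕ r .wf⊕ = wf⊕ (Ren-⊕ˡ r)
Ren-⊕ r .var∋ x = var⊕ r x
Ren-⊕ {Γ = Γ} r .var⊕ {x} {T} v = ∋-⊕ (var⊕ r (subst (λ Γ → Γ ∋ x ∶ T) (⊕-idem Γ) v))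

there-ren : ∀ {Δ a V x ρ T} → Δ ∋ ρ x ∶ ren ρ T →
  (Δ ▸ a ∶ V) ∋ suc (ρ x) ∶ ren (liftRen ρ) (wk T)
there-ren {T = T} v = subst (λ T → _ ∋ _ ∶ T) (sym (ren-wk T)) (there v)

Ren-lift : ∀ {Δ ρ Γ a U k k'} → Ren Δ ρ Γ → Δ ⊢ ren ρ U ≈ ren ρ U ∶ sort k →
  (Δ ⊕) ⊢ ren ρ U ≈ ren ρ U ∶ sort k' →
  Ren (Δ ▸ a ∶ ren ρ U) (liftRen ρ) (Γ ▸ a ∶ U)
Ren-lift r d d⊕ .wf = wf-▸ (wf r) d
Ren-lift r d d⊕ .wf⊕ = wf-▸ (wf⊕ r) d⊕
Ren-lift {Δ} {ρ} {a = rel} {U} r d d⊕ .var∋ here =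
  subst (λ T → (Δ ▸ rel ∶ ren ρ U) ∋ zero ∶ T) (sym (ren-wk U)) here
Ren-lift r d d⊕ .var∋ (there x) = there-ren (var∋ r x)
Ren-lift {Δ} {ρ} {U = U} r d d⊕ .var⊕ here =
  subst (λ T → ((Δ ⊕) ▸ rel ∶ ren ρ U) ∋ zero ∶ T) (sym (ren-wk U)) here
Ren-lift r d d⊕ .var⊕ (there x) = there-ren (var⊕ r x)

mutual
  ren-≈ : ∀ {Δ ρ Γ t t' T} → Ren Δ ρ Γ → Γ ⊢ t ≈ t' ∶ T → Δ ⊢ ren ρ t ≈ ren ρ t' ∶ ren ρ T
  ren-≈ r (≈-sort w) = ≈-sort (wf r)
  ren-≈ r (≈-var w x) = ≈-var (wf r) (var∋ r x)
  ren-≈ r (≈-Π dU dT dT') =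
    ≈-Π (ren-≈ r dU) (ren-≈ (Ren-liftˡ r dU) dT) (ren-≈ (Ren-liftʳ r dU) dT')
  ren-≈ r (≈-lam dU dT dt dT' dt') = ≈-lam (ren-≈ r dU)
    (ren-≈ (Ren-liftˡ r dU) dT) (ren-≈ (Ren-liftˡ r dU) dt)
    (ren-≈ (Ren-liftʳ r dU) dT') (ren-≈ (Ren-liftʳ r dU) dt')
  ren-≈ {Δ} {ρ} r (≈-app {T = T} {j = j} dU dT dt du dTu) =
    subst (λ T → Δ ⊢ _ ≈ _ ∶ T) (sym (ren-[] T))
      (≈-app (ren-≈ r dU) (ren-≈ (Ren-liftˡ r dU) dT) (ren-≈ r dt) (ren-≈-arg r du)
        (subst₂ (λ A B → Δ ⊢ A ≈ B ∶ sort j) (ren-[] T) (ren-[] T) (ren-≈ r dTu)))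
  ren-≈ {Δ} {ρ} r (≈-β {a = a} {U = U} {t = t} {T} {u} dU dT dt du dtu) =
    subst₂ (λ t' T → Δ ⊢ ren ρ (app a (lam a U t) u) ≈ t' ∶ T)
      (sym (ren-[] t)) (sym (ren-[] T))
      (≈-β (ren-≈ r dU) (ren-≈ (Ren-liftˡ r dU) dT) (ren-≈ (Ren-liftˡ r dU) dt) (ren-≈-arg r du)
        (subst₂ (λ t T → Δ ⊢ t ≈ t ∶ T) (ren-[] t) (ren-[] T) (ren-≈ r dtu)))
  ren-≈ {Δ} {ρ} r (≈-η {a = a} {U = U} {T} {i} {j} {t} dU dT dt de) =
    subst (λ t' → Δ ⊢ ren ρ t ≈ lam a (ren ρ U) (app a t' (var zero)) ∶ ren ρ (Π a U i j T))
      (sym (ren-wk t))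
      (≈-η (ren-≈ r dU) (ren-≈ (Ren-liftˡ r dU) dT) (ren-≈ r dt)
        (subst (λ t' → Δ ⊢ lam a (ren ρ U) (app a t' (var zero))
                         ≈ lam a (ren ρ U) (app a t' (var zero)) ∶ ren ρ (Π a U i j T))
          (ren-wk t) (ren-≈ r de)))
  ren-≈ r (≈-sym dT d) = ≈-sym (ren-≈ r dT) (ren-≈ r d)
  ren-≈ r (≈-trans d d') = ≈-trans (ren-≈ r d) (ren-≈ r d')
  ren-≈ r (≈-conv d d') = ≈-conv (ren-≈ r d) (ren-≈ r d')

  ren-≈-arg : ∀ {Δ ρ Γ a u u' U} → Ren Δ ρ Γ → Γ ⊢ u ≈ u' ∶[ a ] U →
    Δ ⊢ ren ρ u ≈ ren ρ u' ∶[ a ] ren ρ U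
  ren-≈-arg r (≈-rel d) = ≈-rel (ren-≈ r d)
  ren-≈-arg r (≈-irr d d') = ≈-irr (ren-≈ (Ren-⊕ r) d) (ren-≈ (Ren-⊕ r) d')

  Ren-liftˡ : ∀ {Δ ρ Γ a U U' k} → Ren Δ ρ Γ → Γ ⊢ U ≈ U' ∶ sort k →
    Ren (Δ ▸ a ∶ ren ρ U) (liftRen ρ) (Γ ▸ a ∶ U)
  Ren-liftˡ r d = Ren-lift r (≈-reflˡ (ren-≈ r d)) (≈-reflˡ (ren-≈ (Ren-⊕ˡ r) d))

  Ren-liftʳ : ∀ {Δ ρ Γ a U U' k} → Ren Δ ρ Γ → Γ ⊢ U ≈ U' ∶ sort k →
    Ren (Δ ▸ a ∶ ren ρ U') (liftRen ρ) (Γ ▸ a ∶ U')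
  Ren-liftʳ r d = Ren-lift r (≈-reflʳ (ren-≈ r d)) (≈-reflʳ (ren-≈ (Ren-⊕ˡ r) d))

∋-id : ∀ {Γ x T} → Γ ∋ x ∶ T → Γ ∋ x ∶ ren id T
∋-id {T = T} = subst (λ T → _ ∋ _ ∶ T) (sym (ren-id T))

Ren-⊕-id : ∀ {Γ} → Wf (Γ ⊕) → Ren (Γ ⊕) id Γ
Ren-⊕-id w .wf = w
Ren-⊕-id {Γ} w .wf⊕ = subst Wf (sym (⊕-idem Γ)) w
Ren-⊕-id w .var∋ x = ∋-id (∋-⊕ x)
Ren-⊕-id w .var⊕ x = ∋-id (∋-⊕ x)

-- Resurrection is a renaming by the identity, so stability of judgements under it is an instance of
-- `ren-≈`. The hypothesis on `Γ ⊕` is discharged afterwards by induction on the context in `wf-⊕`.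
≈-⊕-wf : ∀ {Γ t t' T} → Wf (Γ ⊕) → Γ ⊢ t ≈ t' ∶ T → (Γ ⊕) ⊢ t ≈ t' ∶ T
≈-⊕-wf {t = t} {t'} {T} w d with ren-≈ (Ren-⊕-id w) d
... | d' rewrite ren-id t | ren-id t' | ren-id T = d'

wf-⊕ : ∀ {Γ} → Wf Γ → Wf (Γ ⊕)
wf-⊕ wf-ε       = wf-ε
wf-⊕ (wf-▸ w d) = wf-▸ (wf-⊕ w) (≈-⊕-wf (wf-⊕ w) d)

≈-⊕ : ∀ {Γ t t' T} → Γ ⊢ t ≈ t' ∶ T → (Γ ⊕) ⊢ t ≈ t' ∶ T
≈-⊕ d = ≈-⊕-wf (wf-⊕ (≈-wf d)) d

Ren-id : ∀ {Γ} → Wf Γ → Ren Γ id Γ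
Ren-id w .wf = w
Ren-id w .wf⊕ = wf-⊕ w
Ren-id w .var∋ x = ∋-id x
Ren-id w .var⊕ x = ∋-id x

Ren-wk : ∀ {Γ a U k} → Γ ⊢ U ≈ U ∶ sort k → Ren (Γ ▸ a ∶ U) suc Γ
Ren-wk d .wf = wf-▸ (≈-wf d) d
Ren-wk d .wf⊕ = wf-▸ (wf-⊕ (≈-wf d)) (≈-⊕ d)
Ren-wk d .var∋ x = there x
Ren-wk d .var⊕ x = there x

Ren-∘ : ∀ {Θ Δ Γ ρ' ρ} → Ren Θ ρ' Δ → Ren Δ ρ Γ → Ren Θ (ρ' ∘ ρ) Γ
Ren-∘ r' r .wf = wf r'
Ren-∘ r' r .wf⊕ = wf⊕ r'
Ren-∘ r' r .var∋ {T = T} x = subst (λ T → _ ∋ _ ∶ T) (ren-ren T) (var∋ r' (var∋ r x))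
Ren-∘ r' r .var⊕ {T = T} x = subst (λ T → _ ∋ _ ∶ T) (ren-ren T) (var⊕ r' (var⊕ r x))

wk-≈ : ∀ {Γ a U k t t' T} → Γ ⊢ U ≈ U ∶ sort k → Γ ⊢ t ≈ t' ∶ T →
  (Γ ▸ a ∶ U) ⊢ wk t ≈ wk t' ∶ wk T
wk-≈ dU d = ren-≈ (Ren-wk dU) d

record Sub (Δ : Ctx) (σ : ℕ → Tm) (Γ : Ctx) : Set where
  field
    wfˢ   : Wf Δ
    var≈  : ∀ {x T} → Γ ∋ x ∶ T → Δ ⊢ σ x ≈ σ x ∶ sub σ T
    var≈⊕ : ∀ {x T} → (Γ ⊕) ∋ x ∶ T → (Δ ⊕) ⊢ σ x ≈ σ x ∶ sub σ T

open Sub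

-- Since lookup succeeds only at relevant entries, `eq` says nothing about the images of irrelevant
-- variables. Those are merely well typed on each side, through `var≈⊕` of `left` and `right`,
-- exactly as `≈-irr` demands.
record SubEq (Δ : Ctx) (σ σ' : ℕ → Tm) (Γ : Ctx) : Set where
  constructor subEq
  field
    left  : Sub Δ σ Γ
    right : Sub Δ σ' Γ
    eq    : ∀ {x T} → Γ ∋ x ∶ T → Δ ⊢ σ x ≈ σ' x ∶ sub σ T

open SubEq

SubEq-refl : ∀ {Δ σ Γ} → Sub Δ σ Γ → SubEq Δ σ σ Γ
SubEq-refl s = subEq s s (var≈ s)

Sub-⊕ : ∀ {Δ σ Γ} → Sub Δ σ Γ → Sub (Δ ⊕) σ (Γ ⊕)
Sub-⊕ s .wfˢ = wf-⊕ (wfˢ s)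
Sub-⊕ s .var≈ x = var≈⊕ s x
Sub-⊕ {Γ = Γ} s .var≈⊕ {x} {T} v =
  ≈-⊕ (var≈⊕ s (subst (λ Γ → Γ ∋ x ∶ T) (⊕-idem Γ) v))

wk-sub-≈ : ∀ {Δ a V k σ t t'} T → Δ ⊢ V ≈ V ∶ sort k → Δ ⊢ t ≈ t' ∶ sub σ T →
  (Δ ▸ a ∶ V) ⊢ wk t ≈ wk t' ∶ sub (liftSub σ) (wk T)
wk-sub-≈ T dV d = subst (λ T → _ ⊢ _ ≈ _ ∶ T) (sym (sub-wk T)) (wk-≈ dV d)

var0-≈ : ∀ {Δ V k σ} U → Δ ⊢ V ≈ sub σ U ∶ sort k →
  (Δ ▸ rel ∶ V) ⊢ var zero ≈ var zero ∶ sub (liftSub σ) (wk U)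
var0-≈ U d = subst (λ T → _ ⊢ _ ≈ _ ∶ T) (sym (sub-wk U))
  (≈-conv (≈-var (wf-▸ (≈-wf d) (≈-reflˡ d)) here) (wk-≈ (≈-reflˡ d) d))

-- `V` may differ from the instance of `U`, so that two substitutions can be lifted over one common
-- target context, and so that context conversion becomes a lifted identity.
Sub-lift : ∀ {Δ σ Γ a V U k} → Sub Δ σ Γ → Δ ⊢ V ≈ sub σ U ∶ sort k →
  Sub (Δ ▸ a ∶ V) (liftSub σ) (Γ ▸ a ∶ U)
Sub-lift s d .wfˢ = wf-▸ (wfˢ s) (≈-reflˡ d)
Sub-lift s d .var≈ (here {T = U}) = var0-≈ U d
Sub-lift s d .var≈ (there {T = T} x) = wk-sub-≈ T (≈-reflˡ d) (var≈ s x)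
Sub-lift {U = U} s d .var≈⊕ here = var0-≈ U (≈-⊕ d)
Sub-lift s d .var≈⊕ (there {T = T} x) = wk-sub-≈ T (≈-reflˡ (≈-⊕ d)) (var≈⊕ s x)

SubEq-lift : ∀ {Δ σ σ' Γ a V U k} → SubEq Δ σ σ' Γ → Δ ⊢ V ≈ sub σ U ∶ sort k →
  Δ ⊢ V ≈ sub σ' U ∶ sort k → SubEq (Δ ▸ a ∶ V) (liftSub σ) (liftSub σ') (Γ ▸ a ∶ U)
SubEq-lift s d d' .left = Sub-lift (left s) d
SubEq-lift s d d' .right = Sub-lift (right s) d'
SubEq-lift {U = U} s d d' .eq here = var0-≈ U d
SubEq-lift s d d' .eq (there {T = T} x) = wk-sub-≈ T (≈-reflˡ d) (eq s x)

≈-arg-sym : ∀ {Γ a u u' U k} → Γ ⊢ U ≈ U ∶ sort k → Γ ⊢ u ≈ u' ∶[ a ] U → Γ ⊢ u' ≈ u ∶[ a ] U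
≈-arg-sym dU (≈-rel d)    = ≈-rel (≈-sym dU d)
≈-arg-sym dU (≈-irr d d') = ≈-irr d' d

≈-arg-trans : ∀ {Γ a u u' u'' U} → Γ ⊢ u ≈ u' ∶[ a ] U → Γ ⊢ u' ≈ u'' ∶[ a ] U →
  Γ ⊢ u ≈ u'' ∶[ a ] U
≈-arg-trans (≈-rel d) (≈-rel d')        = ≈-rel (≈-trans d d')
≈-arg-trans (≈-irr d _) (≈-irr _ d')    = ≈-irr d d'

≈-arg-conv : ∀ {Γ a u u' U U' k} → Γ ⊢ u ≈ u' ∶[ a ] U → Γ ⊢ U ≈ U' ∶ sort k →
  Γ ⊢ u ≈ u' ∶[ a ] U'
≈-arg-conv (≈-rel d) dU    = ≈-rel (≈-conv d dU)
≈-arg-conv (≈-irr d d') dU = ≈-irr (≈-conv d (≈-⊕ dU)) (≈-conv d' (≈-⊕ dU))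

≈-arg-⊕ : ∀ {Γ a u U} → Γ ⊢ u ≈ u ∶[ a ] U → (Γ ⊕) ⊢ u ≈ u ∶ U
≈-arg-⊕ (≈-rel d)   = ≈-⊕ d
≈-arg-⊕ (≈-irr d _) = d

cons-var : ∀ {Δ σ u u'} T → Δ ⊢ u ≈ u' ∶ sub (σ ∘ suc) T → Δ ⊢ u ≈ u' ∶ sub σ (wk T)
cons-var T d = subst (λ T → _ ⊢ _ ≈ _ ∶ T) (sym (sub-ren T)) d

Sub-cons : ∀ {Δ σ Γ a U} → Sub Δ (σ ∘ suc) Γ →
  Δ ⊢ σ zero ≈ σ zero ∶[ a ] sub (σ ∘ suc) U → Sub Δ σ (Γ ▸ a ∶ U)
Sub-cons s d .wfˢ = wfˢ s
Sub-cons s (≈-rel d) .var≈ (here {T = T}) = cons-var T d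
Sub-cons s d .var≈ (there {T = T} x) = cons-var T (var≈ s x)
Sub-cons {U = U} s d .var≈⊕ here = cons-var U (≈-arg-⊕ d)
Sub-cons s d .var≈⊕ (there {T = T} x) = cons-var T (var≈⊕ s x)

SubEq-cons : ∀ {Δ σ σ' Γ a u u' U k} → SubEq Δ σ σ' Γ → Δ ⊢ sub σ U ≈ sub σ' U ∶ sort k →
  Δ ⊢ u ≈ u' ∶[ a ] sub σ U → SubEq Δ (u ∙ σ) (u' ∙ σ') (Γ ▸ a ∶ U)
SubEq-cons s dU d .left = Sub-cons (left s) (≈-arg-trans d (≈-arg-sym (≈-reflˡ dU) d))
SubEq-cons s dU d .right =
  Sub-cons (right s) (≈-arg-conv (≈-arg-trans (≈-arg-sym (≈-reflˡ dU) d) d) dU)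
SubEq-cons s dU (≈-rel d) .eq (here {T = T}) = cons-var T d
SubEq-cons s dU d .eq (there {T = T} x) = cons-var T (eq s x)

mutual
  sub-≈ : ∀ {Δ σ σ' Γ t t' T} → SubEq Δ σ σ' Γ → Γ ⊢ t ≈ t' ∶ T →
    Δ ⊢ sub σ t ≈ sub σ' t' ∶ sub σ T
  sub-≈ s (≈-sort w) = ≈-sort (wfˢ (left s))
  sub-≈ s (≈-var w x) = eq s x
  sub-≈ s (≈-Π dU dT dT') = ≈-Π (sub-≈ s dU) (sub-≈ (SubEq-liftˡ s dU) dT)
    (sub-≈ (SubEq-refl (right (SubEq-liftʳ s dU))) dT')
  sub-≈ s (≈-lam dU dT dt dT' dt') = ≈-lam (sub-≈ s dU)
    (sub-≈ (SubEq-refl (left sˡ)) dT) (sub-≈ sˡ dt)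
    (sub-≈ (SubEq-refl (left sʳ)) dT')
    (≈-conv (sub-≈ (SubEq-refl (right sʳ)) dt') (≈-symᵗ (sub-≈ sʳ dT')))
    where sˡ = SubEq-liftˡ s dU
          sʳ = SubEq-liftʳ s dU
  sub-≈ {Δ} s (≈-app {T = T} {j = j} dU dT dt du dTu) =
    subst (λ T → Δ ⊢ _ ≈ _ ∶ T) (sym (sub-[] T))
      (≈-app dU₀ (sub-≈ (SubEq-liftˡ s₀ dU) dT) (sub-≈ s dt) du₀
        -- The arguments are `u` under `σ` and `u'` under `σ'`, while `T` is instantiated by `σ` on
        -- both sides; so this premise is `dT` along two different extensions of `σ`, not an
        -- instance of `dTu`.
        (subst₂ (λ A B → Δ ⊢ A ≈ B ∶ sort j) (sym (lift-[] T)) (sym (lift-[] T))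
          (sub-≈ (SubEq-cons s₀ dU₀ du₀) dT)))
    where s₀ = SubEq-refl (left s)
          dU₀ = sub-≈ s₀ dU
          du₀ = sub-≈-arg s dU du
  sub-≈ {Δ} {σ} s (≈-β {a = a} {U = U} {t = t} {T} {u} dU dT dt du dtu) =
    -- The β-step is taken at the left substitution only; the premise `dtu`, substituted along the
    -- pair, then carries the reduct to the right.
    ≈-trans
      (subst₂ (λ t' T → Δ ⊢ sub σ (app a (lam a U t) u) ≈ t' ∶ T)
        (sym (sub-[] t)) (sym (sub-[] T))
        (≈-β (sub-≈ s₀ dU) (sub-≈ sˡ dT) (sub-≈ sˡ dt) (sub-≈-arg s₀ dU du)
          (subst₂ (λ t T → Δ ⊢ t ≈ t ∶ T) (sub-[] t) (sub-[] T) (sub-≈ s₀ dtu))))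
      (sub-≈ s dtu)
    where s₀ = SubEq-refl (left s)
          sˡ = SubEq-liftˡ s₀ dU
  sub-≈ {Δ} {σ} {σ'} s (≈-η {a = a} {U = U} {T} {i} {j} {t} dU dT dt de) =
    ≈-trans (sub-≈ s dt)
      (≈-conv
        (subst (λ t' → Δ ⊢ sub σ' t ≈ lam a (sub σ' U) (app a t' (var zero)) ∶ sub σ' (Π a U i j T))
          (sym (sub-wk t))
          (≈-η (sub-≈ s₁ dU) (sub-≈ (SubEq-liftˡ s₁ dU) dT) (sub-≈ s₁ dt)
            (subst (λ t' → Δ ⊢ lam a (sub σ' U) (app a t' (var zero))
                             ≈ lam a (sub σ' U) (app a t' (var zero)) ∶ sub σ' (Π a U i j T))
              (sub-wk t) (sub-≈ s₁ de))))
        (≈-symᵗ (≈-Π (sub-≈ s dU) (sub-≈ (SubEq-liftˡ s dU) dT)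
          (sub-≈ (SubEq-refl (right (SubEq-liftʳ s dU))) dT))))
    where s₁ = SubEq-refl (right s)
  -- A zigzag through three instances of `d`: from `t'` to `t` under `σ`, across to `t'` under `σ'`,
  -- and back to `t` under `σ'`.
  sub-≈ s (≈-sym dT d) = ≈-trans
    (≈-sym (sub-≈ s₀ dT) (sub-≈ s₀ d))
    (≈-trans (sub-≈ s d) (≈-conv (≈-sym (sub-≈ s₁ dT) (sub-≈ s₁ d)) (≈-symᵗ (sub-≈ s dT))))
    where s₀ = SubEq-refl (left s)
          s₁ = SubEq-refl (right s)
  sub-≈ s (≈-trans d d') = ≈-trans (sub-≈ (SubEq-refl (left s)) d) (sub-≈ s d')
  sub-≈ s (≈-conv d d') = ≈-conv (sub-≈ s d) (sub-≈ (SubEq-refl (left s)) d')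

  sub-≈-arg : ∀ {Δ σ σ' Γ a u u' U k} → SubEq Δ σ σ' Γ → Γ ⊢ U ≈ U ∶ sort k →
    Γ ⊢ u ≈ u' ∶[ a ] U → Δ ⊢ sub σ u ≈ sub σ' u' ∶[ a ] sub σ U
  sub-≈-arg s dU (≈-rel d) = ≈-rel (sub-≈ s d)
  sub-≈-arg {σ' = σ'} s dU (≈-irr {u' = u'} d d') = ≈-irr (sub-≈ (SubEq-refl (Sub-⊕ (left s))) d)
    (≈-conv (sub-≈ {t = u'} {t' = u'} (SubEq-refl (Sub-⊕ (right s))) d') (≈-⊕ (≈-symᵗ (sub-≈ s dU))))

  -- A reflexivity derivation for `U` is not a subderivation of the rule at hand. Comparing the two
  -- instances of `U` through the instance of `U'` calls `sub-≈` on `d` only, which keeps the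
  -- recursion structural.
  SubEq-liftˡ : ∀ {Δ σ σ' Γ a U U' k} → SubEq Δ σ σ' Γ → Γ ⊢ U ≈ U' ∶ sort k →
    SubEq (Δ ▸ a ∶ sub σ U) (liftSub σ) (liftSub σ') (Γ ▸ a ∶ U)
  SubEq-liftˡ s d = SubEq-lift s (≈-reflˡ (sub-≈ s₀ d))
    (≈-trans (sub-≈ s d) (≈-symᵗ (sub-≈ (SubEq-refl (right s)) d)))
    where s₀ = SubEq-refl (left s)

  SubEq-liftʳ : ∀ {Δ σ σ' Γ a U U' k} → SubEq Δ σ σ' Γ → Γ ⊢ U ≈ U' ∶ sort k →
    SubEq (Δ ▸ a ∶ sub σ' U') (liftSub σ) (liftSub σ') (Γ ▸ a ∶ U')
  SubEq-liftʳ s d = SubEq-lift s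
    (≈-trans (≈-symᵗ (sub-≈ s d)) (sub-≈ (SubEq-refl (left s)) d)) (≈-reflʳ (sub-≈ s d))

-- Validity and equivalence with the declarative system

∋-type : ∀ {Γ x T} → Wf Γ → Γ ∋ x ∶ T → ∃ λ k → Γ ⊢ T ≈ T ∶ sort k
∋-type (wf-▸ w d) here = _ , wk-≈ d d
∋-type (wf-▸ w d) (there x) = _ , wk-≈ d (proj₂ (∋-type w x))

≈-type : ∀ {Γ t t' T} → Γ ⊢ t ≈ t' ∶ T → ∃ λ k → Γ ⊢ T ≈ T ∶ sort k
≈-type (≈-sort w)         = _ , ≈-sort w
≈-type (≈-var w x)        = ∋-type w x
≈-type (≈-Π d _ _)        = _ , ≈-sort (≈-wf d)
≈-type (≈-lam dU dT _ _ _) = _ , ≈-Π (≈-reflˡ dU) dT dT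
≈-type (≈-app _ _ _ _ d)  = _ , ≈-reflˡ d
≈-type (≈-β _ _ _ _ d)    = ≈-type d
≈-type (≈-η dU dT _ _)    = _ , ≈-Π dU dT dT
≈-type (≈-sym d _)        = _ , d
≈-type (≈-trans d _)      = ≈-type d
≈-type (≈-conv _ d)       = _ , ≈-reflʳ d

≈-symm : ∀ {Γ t t' T} → Γ ⊢ t ≈ t' ∶ T → Γ ⊢ t' ≈ t ∶ T
≈-symm d = ≈-sym (proj₂ (≈-type d)) d

≈-left : ∀ {Γ t t' T} → Γ ⊢ t ≈ t' ∶ T → Γ ⊢ t ≈ t ∶ T
≈-left d = ≈-trans d (≈-symm d)

≈-right : ∀ {Γ t t' T} → Γ ⊢ t ≈ t' ∶ T → Γ ⊢ t' ≈ t' ∶ T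
≈-right d = ≈-trans (≈-symm d) d

ΠParts : Ctx → Tm → Set
ΠParts Γ X = ∀ {a U i j T} → X ≐ Π a U i j T →
  (Γ ⊢ U ≈ U ∶ sort i) × ((Γ ▸ a ∶ U) ⊢ T ≈ T ∶ sort j)

-- Symmetry exchanges the endpoints and transitivity passes through an arbitrary middle term, so
-- both endpoints are treated at once and neither is assumed to be a Π. The annotations on Π fix the
-- sorts of the parts.
≈-Π-parts : ∀ {Γ X Y S} → Γ ⊢ X ≈ Y ∶ S → ΠParts Γ X × ΠParts Γ Y
≈-Π-parts (≈-Π dU dT dT') =
  (λ { refl → ≈-reflˡ dU , ≈-reflˡ dT }) , (λ { refl → ≈-reflʳ dU , dT' })
≈-Π-parts (≈-sym _ d) = let l , r = ≈-Π-parts d in r , l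
≈-Π-parts (≈-trans d d') = proj₁ (≈-Π-parts d) , proj₂ (≈-Π-parts d')
≈-Π-parts (≈-conv d _) = ≈-Π-parts d
≈-Π-parts (≈-β _ _ _ _ d) = (λ ()) , proj₁ (≈-Π-parts d)
≈-Π-parts (≈-η _ _ d _) = proj₁ (≈-Π-parts d) , (λ ())
≈-Π-parts (≈-sort _) = (λ ()) , (λ ())
≈-Π-parts (≈-var _ _) = (λ ()) , (λ ())
≈-Π-parts (≈-lam _ _ _ _ _) = (λ ()) , (λ ())
≈-Π-parts (≈-app _ _ _ _ _) = (λ ()) , (λ ())

Π-parts : ∀ {Γ a U i j T Y S} → Γ ⊢ Π a U i j T ≈ Y ∶ S →
  (Γ ⊢ U ≈ U ∶ sort i) × ((Γ ▸ a ∶ U) ⊢ T ≈ T ∶ sort j)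
Π-parts d = proj₁ (≈-Π-parts d) refl

Sub-id : ∀ {Γ} → Wf Γ → Sub Γ var Γ
Sub-id w .wfˢ = w
Sub-id w .var≈ {T = T} x = subst (λ T → _ ⊢ _ ≈ _ ∶ T) (sym (sub-var T)) (≈-var w x)
Sub-id w .var≈⊕ {T = T} x =
  subst (λ T → _ ⊢ _ ≈ _ ∶ T) (sym (sub-var T)) (≈-var (wf-⊕ w) x)

SubEq-single : ∀ {Γ a u u' U k} → Γ ⊢ U ≈ U ∶ sort k → Γ ⊢ u ≈ u' ∶[ a ] U →
  SubEq Γ (u ∙ var) (u' ∙ var) (Γ ▸ a ∶ U)
SubEq-single {Γ} {a} {U = U} {k} dU du = SubEq-cons (SubEq-refl (Sub-id (≈-wf dU)))
  (subst (λ U → Γ ⊢ U ≈ U ∶ sort k) (sym (sub-var U)) dU)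
  (subst (λ U → Γ ⊢ _ ≈ _ ∶[ a ] U) (sym (sub-var U)) du)

single-∙ : ∀ {u} t → t [ u ] ≐ sub (u ∙ var) t
single-∙ = sub-cong (λ { zero → refl ; (suc x) → refl })

≈-[] : ∀ {Γ a u u' U k t t' T} → Γ ⊢ U ≈ U ∶ sort k → (Γ ▸ a ∶ U) ⊢ t ≈ t' ∶ T →
  Γ ⊢ u ≈ u' ∶[ a ] U → Γ ⊢ t [ u ] ≈ t' [ u' ] ∶ T [ u ]
≈-[] {u = u} {u'} {t = t} {t'} {T} dU d du
  rewrite single-∙ {u} t | single-∙ {u'} t' | single-∙ {u} T = sub-≈ (SubEq-single dU du) d

-- Context conversion is substitution by the identity, lifted into a context that declares `U'`
-- where `U` is expected.
≈-ctx : ∀ {Γ a U U' k t t' T} → Γ ⊢ U ≈ U' ∶ sort k → (Γ ▸ a ∶ U) ⊢ t ≈ t' ∶ T →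
  (Γ ▸ a ∶ U') ⊢ t ≈ t' ∶ T
≈-ctx {Γ} {a} {U} {U'} {k} {t} {t'} {T} dU d = subst₂ (λ t t' → _ ⊢ t ≈ t' ∶ T) (e t) (e t')
  (subst (λ T → _ ⊢ _ ≈ _ ∶ T) (e T) (sub-≈ (SubEq-refl (Sub-lift (Sub-id (≈-wf dU))
    (subst (λ U → Γ ⊢ U' ≈ U ∶ sort k) (sym (sub-var U)) (≈-symᵗ dU)))) d))
  where e : ∀ t → sub (liftSub var) t ≐ t
        e t = trans (sub-cong (λ { zero → refl ; (suc x) → refl }) t) (sub-var t)

≈-app′ : ∀ {Γ a t t' u u' U T i j} → Γ ⊢ t ≈ t' ∶ Π a U i j T → Γ ⊢ u ≈ u' ∶[ a ] U →
  Γ ⊢ app a t u ≈ app a t' u' ∶ T [ u ]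
≈-app′ dt du = let dU , dT = Π-parts (proj₂ (≈-type dt)) in
  ≈-app dU dT dt du (≈-[] dU dT du)

≈-β′ : ∀ {Γ a U t T u} → (Γ ▸ a ∶ U) ⊢ t ≈ t ∶ T → Γ ⊢ u ≈ u ∶[ a ] U →
  Γ ⊢ app a (lam a U t) u ≈ t [ u ] ∶ T [ u ]
≈-β′ dt du with ≈-wf dt | ≈-type dt
... | wf-▸ _ dU | _ , dT = ≈-β dU dT dt du (≈-[] dU dt du)

≈-lam′ : ∀ {Γ a U U' T t t' i j} → Γ ⊢ U ≈ U' ∶ sort i → (Γ ▸ a ∶ U) ⊢ T ≈ T ∶ sort j →
  (Γ ▸ a ∶ U) ⊢ t ≈ t' ∶ T → Γ ⊢ lam a U t ≈ lam a U' t' ∶ Π a U i j T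
≈-lam′ dU dT dt = ≈-lam dU dT dt (≈-ctx dU dT) (≈-ctx dU (≈-right dt))

≈-Π′ : ∀ {Γ a U U' T T' i j} → Γ ⊢ U ≈ U' ∶ sort i → (Γ ▸ a ∶ U) ⊢ T ≈ T' ∶ sort j →
  Γ ⊢ Π a U i j T ≈ Π a U' i j T' ∶ sort (i ⊔ j)
≈-Π′ dU dT = ≈-Π dU dT (≈-ctx dU (≈-reflʳ dT))

var0-≈[] : ∀ {Γ a U k} → Γ ⊢ U ≈ U ∶ sort k →
  (Γ ▸ a ∶ U) ⊢ var zero ≈ var zero ∶[ a ] wk U
var0-≈[] {a = rel} d = ≈-rel (≈-var (wf-▸ (≈-wf d) d) here)
var0-≈[] {a = irr} d =
  ≈-irr v v where v = ≈-var (wf-⊕ (wf-▸ {a = irr} (≈-wf d) d)) here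

≈-app-var0 : ∀ {Γ a t t' U T i j} → Γ ⊢ t ≈ t' ∶ Π a U i j T →
  (Γ ▸ a ∶ U) ⊢ app a (wk t) (var zero) ≈ app a (wk t') (var zero) ∶ T
≈-app-var0 {Γ} {a} {t} {t'} {U} {T} d = let dU , dT = Π-parts (proj₂ (≈-type d)) in
  subst (λ T → (Γ ▸ a ∶ U) ⊢ app a (wk t) (var zero) ≈ app a (wk t') (var zero) ∶ T) (lift-var0 T)
    (≈-app′ (wk-≈ dU d) (var0-≈[] dU))

≈-η′ : ∀ {Γ a U T i j t} → Γ ⊢ t ≈ t ∶ Π a U i j T →
  Γ ⊢ t ≈ lam a U (app a (wk t) (var zero)) ∶ Π a U i j T
≈-η′ {Γ} {a} {U} {T} d = let dU , dT = Π-parts (proj₂ (≈-type d)) in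
  ≈-η dU dT d (≈-lam′ dU dT (≈-app-var0 d))

mutual
  to-wf : ∀ {Γ} → ⊢ Γ → Wf Γ
  to-wf ⊢ε = wf-ε
  to-wf (⊢▸ w (_ , d)) = wf-▸ (to-wf w) (to-≈ d)

  to-≈ : ∀ {Γ t T} → Γ ⊢ t ∶ T → Γ ⊢ t ≈ t ∶ T
  to-≈ (ty-sort w) = ≈-sort (to-wf w)
  to-≈ (ty-Π dU dT) = ≈-Π′ (to-≈ dU) (to-≈ dT)
  to-≈ (ty-var w x) = ≈-var (to-wf w) x
  to-≈ (ty-lam dt (_ , dΠ)) = let dU , dT = Π-parts (to-≈ dΠ) in ≈-lam′ dU dT (to-≈ dt)
  to-≈ (ty-app dt du) = ≈-app′ (to-≈ dt) (to-arg du)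
  to-≈ (ty-conv d (_ , e)) = ≈-conv (to-≈ d) (to-eq e)

  to-arg : ∀ {Γ a u U} → Γ ⊢ u ∶[ a ] U → Γ ⊢ u ≈ u ∶[ a ] U
  to-arg (ann-rel d) = ≈-rel (to-≈ d)
  to-arg (ann-irr d) = ≈-irr (to-≈ d) (to-≈ d)

  to-eq : ∀ {Γ t t' T} → Γ ⊢ t ≡ t' ∶ T → Γ ⊢ t ≈ t' ∶ T
  to-eq (eq-β dt du) = ≈-β′ (to-≈ dt) (to-arg du)
  to-eq (eq-η d) = ≈-η′ (to-≈ d)
  to-eq (eq-refl d) = to-≈ d
  to-eq (eq-sym d) = ≈-symm (to-eq d)
  to-eq (eq-trans d d') = ≈-trans (to-eq d) (to-eq d')
  to-eq (eq-Π dU dT) = ≈-Π′ (to-eq dU) (to-eq dT)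
  to-eq (eq-lam dU dT dt) = ≈-lam′ (to-eq dU) (to-≈ dT) (to-eq dt)
  to-eq (eq-app dt du) = ≈-app′ (to-eq dt) (to-eqarg du)
  to-eq (eq-conv d (_ , e)) = ≈-conv (to-eq d) (to-eq e)

  to-eqarg : ∀ {Γ a u u' U} → Γ ⊢ u ≡ u' ∶[ a ] U → Γ ⊢ u ≈ u' ∶[ a ] U
  to-eqarg (eqann-rel d) = ≈-rel (to-eq d)
  to-eqarg (eqann-irr d d') = ≈-irr (to-≈ d) (to-≈ d')

mutual
  from-wf : ∀ {Γ} → Wf Γ → ⊢ Γ
  from-wf wf-ε = ⊢ε
  from-wf (wf-▸ w d) = ⊢▸ (from-wf w) (_ , fromˡ d)

  fromˡ : ∀ {Γ t t' T} → Γ ⊢ t ≈ t' ∶ T → Γ ⊢ t ∶ T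
  fromˡ (≈-sort w) = ty-sort (from-wf w)
  fromˡ (≈-var w x) = ty-var (from-wf w) x
  fromˡ (≈-Π dU dT _) = ty-Π (fromˡ dU) (fromˡ dT)
  fromˡ (≈-lam dU dT dt _ _) = ty-lam (fromˡ dt) (_ , ty-Π (fromˡ dU) (fromˡ dT))
  fromˡ (≈-app _ _ dt du _) = ty-app (fromˡ dt) (from-argˡ du)
  fromˡ (≈-β dU dT dt du _) =
    ty-app (ty-lam (fromˡ dt) (_ , ty-Π (fromˡ dU) (fromˡ dT))) (from-argˡ du)
  fromˡ (≈-η _ _ d _) = fromˡ d
  fromˡ (≈-sym _ d) = fromʳ d
  fromˡ (≈-trans d _) = fromˡ d
  fromˡ (≈-conv d e) = ty-conv (fromˡ d) (_ , from-eq e)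

  -- This is where the extra premises pay off: right endpoints are typed from the components given
  -- over `U'`, and `dTu` converts the type of the right application back to that of the left.
  fromʳ : ∀ {Γ t t' T} → Γ ⊢ t ≈ t' ∶ T → Γ ⊢ t' ∶ T
  fromʳ (≈-sort w) = ty-sort (from-wf w)
  fromʳ (≈-var w x) = ty-var (from-wf w) x
  fromʳ (≈-Π dU _ dT') = ty-Π (fromʳ dU) (fromʳ dT')
  fromʳ (≈-lam dU dT _ dT' dt') =
    ty-conv (ty-lam (fromʳ dt') (_ , ty-Π (fromʳ dU) (fromˡ dT')))
      (_ , eq-sym (eq-Π (from-eq dU) (from-eq dT)))
  fromʳ (≈-app _ _ dt du dTu) = ty-conv (ty-app (fromʳ dt) (from-argʳ du)) (_ , eq-sym (from-eq dTu))
  fromʳ (≈-β _ _ _ _ d) = fromˡ d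
  fromʳ (≈-η _ _ _ d) = fromˡ d
  fromʳ (≈-sym _ d) = fromˡ d
  fromʳ (≈-trans _ d) = fromʳ d
  fromʳ (≈-conv d e) = ty-conv (fromʳ d) (_ , from-eq e)

  from-argˡ : ∀ {Γ a u u' U} → Γ ⊢ u ≈ u' ∶[ a ] U → Γ ⊢ u ∶[ a ] U
  from-argˡ (≈-rel d) = ann-rel (fromˡ d)
  from-argˡ (≈-irr d _) = ann-irr (fromˡ d)

  from-argʳ : ∀ {Γ a u u' U} → Γ ⊢ u ≈ u' ∶[ a ] U → Γ ⊢ u' ∶[ a ] U
  from-argʳ (≈-rel d) = ann-rel (fromʳ d)
  from-argʳ (≈-irr _ d) = ann-irr (fromˡ d)

  from-eq : ∀ {Γ t t' T} → Γ ⊢ t ≈ t' ∶ T → Γ ⊢ t ≡ t' ∶ T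
  from-eq (≈-sort w) = eq-refl (ty-sort (from-wf w))
  from-eq (≈-var w x) = eq-refl (ty-var (from-wf w) x)
  from-eq (≈-Π dU dT _) = eq-Π (from-eq dU) (from-eq dT)
  from-eq (≈-lam dU dT dt _ _) = eq-lam (from-eq dU) (fromˡ dT) (from-eq dt)
  from-eq (≈-app _ _ dt du _) = eq-app (from-eq dt) (from-eqarg du)
  from-eq (≈-β _ _ dt du _) = eq-β (fromˡ dt) (from-argˡ du)
  from-eq (≈-η _ _ d _) = eq-η (fromˡ d)
  from-eq (≈-sym _ d) = eq-sym (from-eq d)
  from-eq (≈-trans d d') = eq-trans (from-eq d) (from-eq d')
  from-eq (≈-conv d e) = eq-conv (from-eq d) (_ , from-eq e)

  from-eqarg : ∀ {Γ a u u' U} → Γ ⊢ u ≈ u' ∶[ a ] U → Γ ⊢ u ≡ u' ∶[ a ] U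
  from-eqarg (≈-rel d) = eqann-rel (from-eq d)
  from-eqarg (≈-irr d d') = eqann-irr (fromˡ d) (fromˡ d')

-- Type conversion and evaluation

infix 4 _⊢_≃_

-- A chain of type equalities, each link at its own sort: until sorts are known to be unique,
-- type equality at an unspecified sort is not transitive.
_⊢_≃_ : Ctx → Tm → Tm → Set
Γ ⊢ A ≃ B = Star (λ A B → ∃ λ k → Γ ⊢ A ≈ B ∶ sort k) A B

≃-one : ∀ {Γ A B k} → Γ ⊢ A ≈ B ∶ sort k → Γ ⊢ A ≃ B
≃-one d = (_ , d) ◅ []

≃-sym : ∀ {Γ A B} → Γ ⊢ A ≃ B → Γ ⊢ B ≃ A
≃-sym = reverse (λ (_ , d) → _ , ≈-symm d)

≃-⊕ : ∀ {Γ A B} → Γ ⊢ A ≃ B → (Γ ⊕) ⊢ A ≃ B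
≃-⊕ = gmap id (λ (_ , d) → _ , ≈-⊕ d)

≃-ren : ∀ {Δ ρ Γ A B} → Ren Δ ρ Γ → Γ ⊢ A ≃ B → Δ ⊢ ren ρ A ≃ ren ρ B
≃-ren {ρ = ρ} r = gmap (ren ρ) (λ (_ , d) → _ , ren-≈ r d)

≈-conv* : ∀ {Γ t t' A B} → Γ ⊢ t ≈ t' ∶ A → Γ ⊢ A ≃ B → Γ ⊢ t ≈ t' ∶ B
≈-conv* d []            = d
≈-conv* d ((_ , e) ◅ c) = ≈-conv* (≈-conv d e) c

≈-arg-conv* : ∀ {Γ a t t' A B} → Γ ⊢ t ≈ t' ∶[ a ] A → Γ ⊢ A ≃ B → Γ ⊢ t ≈ t' ∶[ a ] B
≈-arg-conv* (≈-rel d) c    = ≈-rel (≈-conv* d c)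
≈-arg-conv* (≈-irr d d') c = ≈-irr (≈-conv* d (≃-⊕ c)) (≈-conv* d' (≃-⊕ c))

↘-whnf : ∀ {t a} → t ↘ a → Whnf a
·-whnf : ∀ {b t u a} → t ·[ b ] u ↘ a → Whnf a
↘-whnf (ev-whnf w)  = w
↘-whnf (ev-app _ e) = ·-whnf e
·-whnf (ap-β e)     = ↘-whnf e
·-whnf (ap-ne n)    = wh-ne (ne-app n)

Neutral-↘ : ∀ {n a} → Neutral n → n ↘ a → a ≐ n
Neutral-↘ n (ev-whnf _) = refl
Neutral-↘ (ne-app n) (ev-app e e') with Neutral-↘ n e
Neutral-↘ (ne-app ()) (ev-app e (ap-β _)) | refl
Neutral-↘ (ne-app n) (ev-app e (ap-ne _)) | refl = refl

Whnf-↘ : ∀ {t a} → Whnf t → t ↘ a → a ≐ t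
Whnf-↘ w (ev-whnf _) = refl
Whnf-↘ (wh-ne n) e = Neutral-↘ n e

↘-det : ∀ {t a b} → t ↘ a → t ↘ b → a ≐ b
·-det : ∀ {c t u a b} → t ·[ c ] u ↘ a → t ·[ c ] u ↘ b → a ≐ b
↘-det (ev-whnf w) e = sym (Whnf-↘ w e)
↘-det e (ev-whnf w) = Whnf-↘ w e
↘-det (ev-app e f) (ev-app e' f') with ↘-det e e'
... | refl = ·-det f f'
·-det (ap-β e) (ap-β e')   = ↘-det e e'
·-det (ap-ne n) (ap-ne n') = refl

ren-Neutral : ∀ {ρ n} → Neutral n → Neutral (ren ρ n)
ren-Neutral ne-var     = ne-var
ren-Neutral (ne-app n) = ne-app (ren-Neutral n)

ren-Whnf : ∀ {ρ a} → Whnf a → Whnf (ren ρ a)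
ren-Whnf wh-sort   = wh-sort
ren-Whnf wh-Π      = wh-Π
ren-Whnf wh-lam    = wh-lam
ren-Whnf (wh-ne n) = wh-ne (ren-Neutral n)

ren-↘ : ∀ {ρ t a} → t ↘ a → ren ρ t ↘ ren ρ a
ren-· : ∀ {ρ b t u a} → t ·[ b ] u ↘ a → ren ρ t ·[ b ] ren ρ u ↘ ren ρ a
ren-↘ (ev-whnf w)  = ev-whnf (ren-Whnf w)
ren-↘ (ev-app e f) = ev-app (ren-↘ e) (ren-· f)
ren-· {ρ} (ap-β {t = t} e) = ap-β (subst (_↘ _) (ren-[] t) (ren-↘ e))
ren-· (ap-ne n) = ap-ne (ren-Neutral n)

infix 4 _⟶_

data _⟶_ : Tm → Tm → Set where
  β⟶   : ∀ {a U t u} → app a (lam a U t) u ⟶ t [ u ]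
  app⟶ : ∀ {a t t' u} → t ⟶ t' → app a t u ⟶ app a t' u

⟶-↘ : ∀ {t t' a} → t ⟶ t' → t' ↘ a → t ↘ a
⟶-↘ β⟶ e = ev-app (ev-whnf wh-lam) (ap-β e)
⟶-↘ (app⟶ r) (ev-app e f) = ev-app (⟶-↘ r e) f
⟶-↘ (app⟶ r) (ev-whnf (wh-ne (ne-app n))) = ev-app (⟶-↘ r (ev-whnf (wh-ne n))) (ap-ne n)

ren-⟶ : ∀ {ρ t t'} → t ⟶ t' → ren ρ t ⟶ ren ρ t'
ren-⟶ {ρ} (β⟶ {a} {U} {t} {u}) =
  subst (app a (ren ρ (lam a U t)) (ren ρ u) ⟶_) (sym (ren-[] t)) β⟶
ren-⟶ (app⟶ r) = app⟶ (ren-⟶ r)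

-- The logical relation

infix 4 _⊢_⇓_

_⊢_⇓_ : Ctx → Tm → Tm → Set
Γ ⊢ A ⇓ B = A ↘ B × Γ ⊢ A ≃ B

ArgRel : Ann → Ctx → Tm → (Tm → Tm → Set) → Tm → Tm → Set
ArgRel rel Δ U E u u' = E u u'
ArgRel irr Δ U E u u' = Δ ⊢ u ≈ u' ∶[ irr ] U

-- Terms of type `sort j` are related when they are related types of level `j`. Taking all lower
-- levels as a parameter keeps the inductive-recursive definition within one level; the hierarchy is
-- then tied together by recursion on `k`.
module Universe (k : ℕ) (below : ∀ {j} → j <′ k → Ctx → Tm → Tm → Set) where
  mutual
    data Ty (Γ : Ctx) (A B : Tm) : Set where
      Ty-sort : ∀ {j} (j<k : j <′ k) → Γ ⊢ A ⇓ sort j → Γ ⊢ B ⇓ sort j → Ty Γ A B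
      Ty-ne   : ∀ {N N'} → Γ ⊢ A ⇓ N → Γ ⊢ B ⇓ N' → Neutral N → Neutral N' →
                Γ ⊢ N ≃ N' → Ty Γ A B
      Ty-Π    : ∀ {a U U' T T' i j} → Γ ⊢ A ⇓ Π a U i j T → Γ ⊢ B ⇓ Π a U' i j T' →
                Γ ⊢ U ≈ U' ∶ sort i → (Γ ▸ a ∶ U) ⊢ T ≈ T' ∶ sort j →
                (dom : ∀ {Δ ρ} → Ren Δ ρ Γ → Ty Δ (ren ρ U) (ren ρ U')) →
                (∀ {Δ ρ} (r : Ren Δ ρ Γ) {u u'} → ArgRel a Δ (ren ρ U) (El (dom r)) u u' →
                  Ty Δ (ren (liftRen ρ) T [ u ]) (ren (liftRen ρ) T' [ u' ])) →
                Ty Γ A B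

    -- The recursion compares terms at the whnf of the left type. Hence the right type can be
    -- exchanged freely (`El-irr`), whereas a change of the left type has to go through symmetry
    -- (`El-irrʳ`).
    El : ∀ {Γ A B} → Ty Γ A B → Tm → Tm → Set
    El {Γ} (Ty-sort {j} j<k _ _) t t' = Γ ⊢ t ≈ t' ∶ sort j × below j<k Γ t t'
    El {Γ} (Ty-ne {N} _ _ _ _ _) t t' = Γ ⊢ t ≈ t' ∶ N
    El {Γ} (Ty-Π {a} {U} {U'} {T} {T'} {i} {j} _ _ _ _ dom cod) t t' =
      Γ ⊢ t ≈ t' ∶ Π a U i j T ×
      (∀ {Δ ρ} (r : Ren Δ ρ Γ) {u u'} (e : ArgRel a Δ (ren ρ U) (El (dom r)) u u') →
        El (cod r e) (app a (ren ρ t) u) (app a (ren ρ t') u'))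

open Universe using (Ty-sort; Ty-ne; Ty-Π)

below : ∀ k {j} → j <′ k → Ctx → Tm → Tm → Set
below (suc k) <′-base     = Universe.Ty k (below k)
below (suc k) (≤′-step p) = below k p

Ty : ℕ → Ctx → Tm → Tm → Set
Ty k = Universe.Ty k (below k)

El : ∀ {k Γ A B} → Ty k Γ A B → Tm → Tm → Set
El {k} = Universe.El k (below k)

below-Ty : ∀ {j k} (p : j <′ k) → below k p ≐ Ty j
below-Ty {k = suc k} <′-base     = refl
below-Ty {k = suc k} (≤′-step p) = below-Ty p

lower : ∀ {j k} (p : j <′ k) {Γ A B} → below k p Γ A B → Ty j Γ A B
lower p {Γ} {A} {B} = subst (λ R → R Γ A B) (below-Ty p)

raise : ∀ {j k} (p : j <′ k) {Γ A B} → Ty j Γ A B → below k p Γ A B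
raise p {Γ} {A} {B} = subst (λ R → R Γ A B) (sym (below-Ty p))

sort≢Neutral : ∀ {A j N} → A ↘ sort j → A ↘ N → Neutral N → {P : Set} → P
sort≢Neutral e e' n with ↘-det e e'
sort≢Neutral e e' () | refl

Π≢Neutral : ∀ {A a U i j T N} → A ↘ Π a U i j T → A ↘ N → Neutral N → {P : Set} → P
Π≢Neutral e e' n with ↘-det e e'
Π≢Neutral e e' () | refl

sort≢Π : ∀ {A k a U i j T} → A ↘ sort k → A ↘ Π a U i j T → {P : Set} → P
sort≢Π e e' with ↘-det e e'
... | ()

-- Invariance, symmetry and transitivity of the relation

_⟺_ : (Tm → Tm → Set) → (Tm → Tm → Set) → Set
E ⟺ E' = ∀ {t t'} → (E t t' → E' t t') × (E' t t' → E t t')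

ArgRel-⟺ : ∀ a {Δ U E E'} → E ⟺ E' → ArgRel a Δ U E ⟺ ArgRel a Δ U E'
ArgRel-⟺ rel f = f
ArgRel-⟺ irr f = id , id

-- Determinism of evaluation forces both derivations to the same whnf of `A`. Levels may differ,
-- since terms at `sort j` are always compared at level `j`. In the Π case the two codomain
-- derivations again share their left type, as it mentions only the left argument.
El-irr : ∀ {k k' Γ A B C} (D : Ty k Γ A B) (D' : Ty k' Γ A C) → El D ⟺ El D'
El-irr (Ty-sort p (e , _) _) (Ty-sort q (e' , _) _) with ↘-det e e'
... | refl = (λ (d , R) → d , raise q (lower p R)) , (λ (d , R) → d , raise p (lower q R))
El-irr (Ty-ne (e , _) _ _ _ _) (Ty-ne (e' , _) _ _ _ _) with ↘-det e e'
... | refl = id , id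
El-irr (Ty-Π {a} (e , _) _ _ _ dom cod) (Ty-Π (e' , _) _ _ _ dom' cod') with ↘-det e e'
... | refl =
  (λ (d , f) → d , λ r x →
    let y = proj₂ (ArgRel-⟺ a (El-irr (dom r) (dom' r))) x
    in proj₁ (El-irr (cod r y) (cod' r x)) (f r y)) ,
  (λ (d , f) → d , λ r x →
    let y = proj₁ (ArgRel-⟺ a (El-irr (dom r) (dom' r))) x
    in proj₂ (El-irr (cod r x) (cod' r y)) (f r y))
El-irr (Ty-sort _ (e , _) _) (Ty-ne (e' , _) _ n _ _) = sort≢Neutral e e' n
El-irr (Ty-sort _ (e , _) _) (Ty-Π (e' , _) _ _ _ _ _) = sort≢Π e e'
El-irr (Ty-ne (e , _) _ n _ _) (Ty-sort _ (e' , _) _) = sort≢Neutral e' e n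
El-irr (Ty-ne (e , _) _ n _ _) (Ty-Π (e' , _) _ _ _ _ _) = Π≢Neutral e' e n
El-irr (Ty-Π (e , _) _ _ _ _ _) (Ty-sort _ (e' , _) _) = sort≢Π e' e
El-irr (Ty-Π (e , _) _ _ _ _ _) (Ty-ne (e' , _) _ n _ _) = Π≢Neutral e e' n

Ty-≃ : ∀ {k Γ A B} → Ty k Γ A B → Γ ⊢ A ≃ B
Ty-≃ (Ty-sort _ (_ , c) (_ , c')) = c ◅◅ ≃-sym c'
Ty-≃ (Ty-ne (_ , c) (_ , c') _ _ e) = c ◅◅ e ◅◅ ≃-sym c'
Ty-≃ (Ty-Π (_ , c) (_ , c') dU dT _ _) = c ◅◅ ≃-one (≈-Π′ dU dT) ◅◅ ≃-sym c'

El-≈ : ∀ {k Γ A B} (D : Ty k Γ A B) {t t'} → El D t t' → Γ ⊢ t ≈ t' ∶ A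
El-≈ (Ty-sort _ (_ , c) _) (d , _) = ≈-conv* d (≃-sym c)
El-≈ (Ty-ne (_ , c) _ _ _ _) d = ≈-conv* d (≃-sym c)
El-≈ (Ty-Π (_ , c) _ _ _ _ _) (d , _) = ≈-conv* d (≃-sym c)

ArgRel-≈ : ∀ a {k Γ A B} (D : Ty k Γ A B) {u u'} → ArgRel a Γ A (El D) u u' → Γ ⊢ u ≈ u' ∶[ a ] A
ArgRel-≈ rel D e = ≈-rel (El-≈ D e)
ArgRel-≈ irr D e = e

irr-sym : ∀ {Γ u u' U} → Γ ⊢ u ≈ u' ∶[ irr ] U → Γ ⊢ u' ≈ u ∶[ irr ] U
irr-sym (≈-irr d d') = ≈-irr d' d

Swap : (Tm → Tm → Set) → (Tm → Tm → Set) → Set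
Swap E E' = ∀ {t t'} → (E t t' → E' t' t) × (E' t' t → E t t')

ArgRel-swap : ∀ a {Δ U U' E E'} → Δ ⊢ U ≃ U' → Swap E E' → Swap (ArgRel a Δ U E) (ArgRel a Δ U' E')
ArgRel-swap rel c s = s
ArgRel-swap irr c s = (λ e → irr-sym (≈-arg-conv* e c)) , (λ e → irr-sym (≈-arg-conv* e (≃-sym c)))

-- The exchange of terms must be proved together with symmetry of types, as an equivalence, because
-- domains occur contravariantly. The accessibility argument covers the sort case, where the
-- recursion continues in a derivation stored in `El` at a lower level.
Ty-sym′ : ∀ {k Γ A B} → Acc _<′_ k → (D : Ty k Γ A B) → Σ (Ty k Γ B A) λ D' → Swap (El D) (El D')
Ty-sym′ (acc rs) (Ty-sort p e e') = Ty-sort p e' e ,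
  ((λ (d , R) → ≈-symm d , raise p (proj₁ (Ty-sym′ (rs p) (lower p R)))) ,
   (λ (d , R) → ≈-symm d , raise p (proj₁ (Ty-sym′ (rs p) (lower p R)))))
Ty-sym′ _ (Ty-ne e e' n n' c) = Ty-ne e' e n' n (≃-sym c) ,
  ((λ d → ≈-symm (≈-conv* d c)) , (λ d → ≈-symm (≈-conv* d (≃-sym c))))
Ty-sym′ {k} {Γ} w (Ty-Π {a} {U} {U'} {T} {T'} e e' dU dT dom cod) =
  Ty-Π e' e (≈-symm dU) (≈-symm (≈-ctx dU dT)) dom' cod' ,
  ((λ (d , f) → ≈-symm (≈-conv d (≈-Π′ dU dT)) , λ r x →
      proj₁ (proj₂ (Ty-sym′ w (cod r (unswap r x)))) (f r (unswap r x))) ,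
   (λ (d , f) → ≈-symm (≈-conv d (≈-symm (≈-Π′ dU dT))) , λ r x →
      let y = proj₁ (ArgRel-swap a (≃-ren r (≃-one dU)) (proj₂ (Ty-sym′ w (dom r)))) x
      in proj₁ (El-irr (cod r (unswap r y)) (cod r x))
           (proj₂ (proj₂ (Ty-sym′ w (cod r (unswap r y)))) (f r y))))
  where
    dom' : ∀ {Δ ρ} → Ren Δ ρ Γ → Ty k Δ (ren ρ U') (ren ρ U)
    dom' r = proj₁ (Ty-sym′ w (dom r))
    unswap : ∀ {Δ ρ} (r : Ren Δ ρ Γ) {u u'} → ArgRel a Δ (ren ρ U') (El (dom' r)) u u' →
      ArgRel a Δ (ren ρ U) (El (dom r)) u' u
    unswap r x = proj₂ (ArgRel-swap a (≃-ren r (≃-one dU)) (proj₂ (Ty-sym′ w (dom r)))) x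
    cod' : ∀ {Δ ρ} (r : Ren Δ ρ Γ) {u u'} → ArgRel a Δ (ren ρ U') (El (dom' r)) u u' →
      Ty k Δ (ren (liftRen ρ) T' [ u ]) (ren (liftRen ρ) T [ u' ])
    cod' r x = proj₁ (Ty-sym′ w (cod r (unswap r x)))

Ty-sym : ∀ {k Γ A B} → Ty k Γ A B → Ty k Γ B A
Ty-sym D = proj₁ (Ty-sym′ (<′-wellFounded _) D)

El-swap : ∀ {k Γ A B} (D : Ty k Γ A B) → Swap (El D) (El (Ty-sym D))
El-swap D = proj₂ (Ty-sym′ (<′-wellFounded _) D)

El-irrʳ : ∀ {k k' Γ A B C} (D : Ty k Γ A C) (D' : Ty k' Γ B C) {t t'} → El D t t' → El D' t t'
El-irrʳ D D' x = proj₂ (El-swap D') (proj₁ (El-irr (Ty-sym D) (Ty-sym D')) (proj₁ (El-swap D) x))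

ArgRel-map : ∀ a {Δ U U' E E' u u'} → Δ ⊢ U ≃ U' → (E u u' → E' u u') →
  ArgRel a Δ U E u u' → ArgRel a Δ U' E' u u'
ArgRel-map rel c f x = f x
ArgRel-map irr c f x = ≈-arg-conv* x c

ArgRel-reflˡ : ∀ a {Δ U E u u'} → (E u u' → E u u) → ArgRel a Δ U E u u' → ArgRel a Δ U E u u
ArgRel-reflˡ rel f x = f x
ArgRel-reflˡ irr f x = ≈-arg-trans x (irr-sym x)

ArgRel-symm : ∀ a {Δ U E u u'} → (E u u' → E u' u) → ArgRel a Δ U E u u' → ArgRel a Δ U E u' u
ArgRel-symm rel f x = f x
ArgRel-symm irr f x = irr-sym x

Compose : (E E' E'' : Tm → Tm → Set) → Set
Compose E E' E'' = ∀ {t t' t''} → E t t' → E' t' t'' → E'' t t''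

mutual
  -- To compose codomains at `u` and `u'`, the first is used at `u` and `u`, the second at `u` and
  -- `u'`. That needs left reflexivity at the domain, hence the mutual recursion. The two levels are
  -- independent so that conversions at different sorts can be composed.
  Ty-trans′ : ∀ {k k' Γ A B C} → Acc _<′_ k → (D : Ty k Γ A B) (D' : Ty k' Γ B C) →
    Σ (Ty k Γ A C) λ D'' → Compose (El D) (El D') (El D'')
  Ty-trans′ (acc rs) (Ty-sort p e (f , _)) (Ty-sort q (f' , _) e') with ↘-det f f'
  ... | refl = Ty-sort p e e' , λ (d , R) (d' , R') →
    ≈-trans d d' , raise p (proj₁ (Ty-trans′ (rs p) (lower p R) (lower q R')))
  Ty-trans′ _ (Ty-ne e (f , _) n _ c) (Ty-ne (f' , _) e' _ n' c') with ↘-det f f'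
  ... | refl = Ty-ne e e' n n' (c ◅◅ c') , λ d d' → ≈-trans d (≈-conv* d' (≃-sym c))
  Ty-trans′ {k} {Γ = Γ} w (Ty-Π {a} {U} {T = T} e (f , _) dU dT dom cod)
    (Ty-Π {U' = U''} {T' = T''} (f' , _) e' dU' dT' dom' cod') with ↘-det f f'
  ... | refl = Ty-Π e e' (≈-trans dU dU') (≈-trans dT (≈-ctx (≈-symm dU) dT')) dom'' cod'' ,
    λ (d , g) (d' , g') → ≈-trans d (≈-conv d' (≈-symm (≈-Π′ dU dT))) , λ r x →
      proj₂ (Ty-trans′ w (cod r (arg r x)) (cod' r (arg' r x))) (g r (arg r x)) (g' r (arg' r x))
    where
      dom'' : ∀ {Δ ρ} → Ren Δ ρ Γ → Ty k Δ (ren ρ U) (ren ρ U'')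
      dom'' r = proj₁ (Ty-trans′ w (dom r) (dom' r))
      arg : ∀ {Δ ρ} (r : Ren Δ ρ Γ) {u u'} → ArgRel a Δ (ren ρ U) (El (dom'' r)) u u' →
        ArgRel a Δ (ren ρ U) (El (dom r)) u u
      arg r x = ArgRel-reflˡ a (El-reflˡ′ w (dom r))
        (ArgRel-map a [] (proj₁ (El-irr (dom'' r) (dom r))) x)
      arg' : ∀ {Δ ρ} (r : Ren Δ ρ Γ) {u u'} → ArgRel a Δ (ren ρ U) (El (dom'' r)) u u' →
        ArgRel a Δ _ (El (dom' r)) u u'
      arg' r x = ArgRel-map a (≃-ren r (≃-one dU)) (El-irrʳ (dom'' r) (dom' r)) x
      cod'' : ∀ {Δ ρ} (r : Ren Δ ρ Γ) {u u'} → ArgRel a Δ (ren ρ U) (El (dom'' r)) u u' →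
        Ty k Δ (ren (liftRen ρ) T [ u ]) (ren (liftRen ρ) T'' [ u' ])
      cod'' r x = proj₁ (Ty-trans′ w (cod r (arg r x)) (cod' r (arg' r x)))
  Ty-trans′ _ (Ty-sort _ _ (e , _)) (Ty-ne (e' , _) _ n _ _) = sort≢Neutral e e' n
  Ty-trans′ _ (Ty-sort _ _ (e , _)) (Ty-Π (e' , _) _ _ _ _ _) = sort≢Π e e'
  Ty-trans′ _ (Ty-ne _ (e , _) _ n _) (Ty-sort _ (e' , _) _) = sort≢Neutral e' e n
  Ty-trans′ _ (Ty-ne _ (e , _) _ n _) (Ty-Π (e' , _) _ _ _ _ _) = Π≢Neutral e' e n
  Ty-trans′ _ (Ty-Π _ (e , _) _ _ _ _) (Ty-sort _ (e' , _) _) = sort≢Π e' e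
  Ty-trans′ _ (Ty-Π _ (e , _) _ _ _ _) (Ty-ne (e' , _) _ n _ _) = Π≢Neutral e e' n

  -- `El-swap` reverses the terms but leaves them at left type `B`. As `Ty-sym D` and the composite
  -- of `D` with it share the right endpoint `A`, they can be brought back to left type `A`.
  El-symm′ : ∀ {k Γ A B t t'} → Acc _<′_ k → (D : Ty k Γ A B) → El D t t' → El D t' t
  El-symm′ w D x = let D' = proj₁ (Ty-trans′ w D (Ty-sym D)) in
    proj₁ (El-irr D' D) (El-irrʳ (Ty-sym D) D' (proj₁ (El-swap D) x))

  El-reflˡ′ : ∀ {k Γ A B t t'} → Acc _<′_ k → (D : Ty k Γ A B) → El D t t' → El D t t
  El-reflˡ′ (acc rs) (Ty-sort p _ _) (d , R) =
    ≈-left d , raise p (proj₁ (Ty-trans′ (rs p) (lower p R) (Ty-sym (lower p R))))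
  El-reflˡ′ _ (Ty-ne _ _ _ _ _) d = ≈-left d
  El-reflˡ′ w (Ty-Π {a} _ _ _ _ dom cod) (d , f) = ≈-left d , λ r x →
    -- With `y` relating `u'` to itself, `t u` is related to `t' u'` by `x`, and `t' u'` to `t u'`
    -- by `y` reversed.
    let y = ArgRel-reflˡ a (El-reflˡ′ w (dom r)) (ArgRel-symm a (El-symm′ w (dom r)) x)
        D = Ty-trans′ w (cod r x) (Ty-sym (cod r y))
    in proj₁ (El-irr (proj₁ D) (cod r x)) (proj₂ D (f r x) (proj₁ (El-swap (cod r y)) (f r y)))

Ty-trans : ∀ {k k' Γ A B C} → Ty k Γ A B → Ty k' Γ B C → Ty k Γ A C
Ty-trans D D' = proj₁ (Ty-trans′ (<′-wellFounded _) D D')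

El-trans : ∀ {k k' Γ A B C} (D : Ty k Γ A B) (D' : Ty k' Γ B C) →
  Compose (El D) (El D') (El (Ty-trans D D'))
El-trans D D' = proj₂ (Ty-trans′ (<′-wellFounded _) D D')

El-symm : ∀ {k Γ A B t t'} (D : Ty k Γ A B) → El D t t' → El D t' t
El-symm = El-symm′ (<′-wellFounded _)

El-reflˡ : ∀ {k Γ A B t t'} (D : Ty k Γ A B) → El D t t' → El D t t
El-reflˡ = El-reflˡ′ (<′-wellFounded _)

El-cast : ∀ {k k' Γ A B C t t'} (D : Ty k Γ A B) (D' : Ty k' Γ A C) → El D t t' → El D' t t'
El-cast D D' = proj₁ (El-irr D D')

-- Cumulativity, renaming, weak head expansion and reflection of neutrals

Ty-cumul : ∀ {k k' Γ A B} → k ≤′ k' → Ty k Γ A B → Ty k' Γ A B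
Ty-cumul le (Ty-sort p e e') = Ty-sort (≤′-trans p le) e e'
Ty-cumul le (Ty-ne e e' n n' c) = Ty-ne e e' n n' c
Ty-cumul le (Ty-Π {a} e e' dU dT dom cod) = Ty-Π e e' dU dT (λ r → Ty-cumul le (dom r))
  (λ r x → Ty-cumul le (cod r (proj₁ (ArgRel-⟺ a (El-irr (Ty-cumul le (dom r)) (dom r))) x)))

⇓-ren : ∀ {Δ ρ Γ A B} → Ren Δ ρ Γ → Γ ⊢ A ⇓ B → Δ ⊢ ren ρ A ⇓ ren ρ B
⇓-ren r (e , c) = ren-↘ e , ≃-ren r c

ren-lift-ren : ∀ {ρ' ρ} t → ren (liftRen ρ') (ren (liftRen ρ) t) ≐ ren (liftRen (ρ' ∘ ρ)) t
ren-lift-ren t = trans (ren-ren t) (ren-cong (λ { zero → refl ; (suc x) → refl }) t)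

El-subst : ∀ {k Γ A A' B B' t t'} (p : A ≐ A') (q : B ≐ B') (D : Ty k Γ A B) →
  El D t t' → El (subst₂ (Ty k Γ) p q D) t t'
El-subst refl refl D x = x

El-subst⁻ : ∀ {k Γ A A' B B' t t'} (p : A ≐ A') (q : B ≐ B') (D : Ty k Γ A B) →
  El (subst₂ (Ty k Γ) p q D) t t' → El D t t'
El-subst⁻ refl refl D x = x

ArgRel-subst : ∀ a {Δ U U' E u u'} → U ≐ U' → ArgRel a Δ U E u u' → ArgRel a Δ U' E u u'
ArgRel-subst a refl x = x

Ty-ren′ : ∀ {k Δ ρ Γ A B} → Acc _<′_ k → Ren Δ ρ Γ → (D : Ty k Γ A B) →
  Σ (Ty k Δ (ren ρ A) (ren ρ B)) λ D' → ∀ {t t'} → El D t t' → El D' (ren ρ t) (ren ρ t')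
Ty-ren′ (acc rs) r (Ty-sort p e e') = Ty-sort p (⇓-ren r e) (⇓-ren r e') ,
  λ (d , R) → ren-≈ r d , raise p (proj₁ (Ty-ren′ (rs p) r (lower p R)))
Ty-ren′ _ r (Ty-ne e e' n n' c) =
  Ty-ne (⇓-ren r e) (⇓-ren r e') (ren-Neutral n) (ren-Neutral n') (≃-ren r c) , ren-≈ r
Ty-ren′ {k} {Δ} {ρ} w r (Ty-Π {a} {U} {U'} {T} {T'} e e' dU dT dom cod) =
  Ty-Π (⇓-ren r e) (⇓-ren r e') (ren-≈ r dU) (ren-≈ (Ren-liftˡ r dU) dT) dom' cod' ,
  λ {t} {t'} (d , f) → ren-≈ r d , λ r' {u} {u'} x →
    El-subst (cod-ren T) (cod-ren T') (cod (Ren-∘ r' r) (arg r' x))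
      (subst₂ (λ t t' → El (cod (Ren-∘ r' r) (arg r' x)) (app a t u) (app a t' u'))
        (sym (ren-ren t)) (sym (ren-ren t')) (f (Ren-∘ r' r) (arg r' x)))
  where
    dom' : ∀ {Θ ρ'} → Ren Θ ρ' Δ → Ty k Θ (ren ρ' (ren ρ U)) (ren ρ' (ren ρ U'))
    dom' r' = subst₂ (Ty k _) (sym (ren-ren U)) (sym (ren-ren U')) (dom (Ren-∘ r' r))
    arg : ∀ {Θ ρ'} (r' : Ren Θ ρ' Δ) {u u'} → ArgRel a Θ (ren ρ' (ren ρ U)) (El (dom' r')) u u' →
      ArgRel a Θ (ren (ρ' ∘ ρ) U) (El (dom (Ren-∘ r' r))) u u'
    arg {Θ} r' x = ArgRel-subst a (ren-ren U)
      (ArgRel-map a [] (El-subst⁻ (sym (ren-ren U)) (sym (ren-ren U')) (dom (Ren-∘ r' r))) x)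
    cod-ren : ∀ {ρ'} T {u} → ren (liftRen (ρ' ∘ ρ)) T [ u ] ≐ ren (liftRen ρ') (ren (liftRen ρ) T) [ u ]
    cod-ren T {u} = cong (_[ u ]) (sym (ren-lift-ren T))
    cod' : ∀ {Θ ρ'} (r' : Ren Θ ρ' Δ) {u u'} →
      ArgRel a Θ (ren ρ' (ren ρ U)) (El (dom' r')) u u' →
      Ty k Θ (ren (liftRen ρ') (ren (liftRen ρ) T) [ u ]) (ren (liftRen ρ') (ren (liftRen ρ) T') [ u' ])
    cod' r' x = subst₂ (Ty k _) (cod-ren T) (cod-ren T') (cod (Ren-∘ r' r) (arg r' x))

Ty-ren : ∀ {k Δ ρ Γ A B} → Ren Δ ρ Γ → Ty k Γ A B → Ty k Δ (ren ρ A) (ren ρ B)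
Ty-ren r D = proj₁ (Ty-ren′ (<′-wellFounded _) r D)

El-ren : ∀ {k Δ ρ Γ A B t t'} (r : Ren Δ ρ Γ) (D : Ty k Γ A B) →
  El D t t' → El (Ty-ren r D) (ren ρ t) (ren ρ t')
El-ren r D = proj₂ (Ty-ren′ (<′-wellFounded _) r D)

Ty-expand : ∀ {k Γ A A' B} → A ⟶ A' → Γ ⊢ A ≃ A' → Ty k Γ A' B → Ty k Γ A B
Ty-expand s c (Ty-sort p (e , c') e') = Ty-sort p (⟶-↘ s e , c ◅◅ c') e'
Ty-expand s c (Ty-ne (e , c') e' n n' c'') = Ty-ne (⟶-↘ s e , c ◅◅ c') e' n n' c''
Ty-expand s c (Ty-Π (e , c') e' dU dT dom cod) = Ty-Π (⟶-↘ s e , c ◅◅ c') e' dU dT dom cod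

ArgRel-≈ˡ : ∀ a {k Γ A B} (D : Ty k Γ A B) {u u'} → ArgRel a Γ A (El D) u u' → Γ ⊢ u ≈ u ∶[ a ] A
ArgRel-≈ˡ rel D x = ≈-rel (≈-left (El-≈ D x))
ArgRel-≈ˡ irr D x = ≈-arg-trans x (irr-sym x)

El-expand : ∀ {k Γ A B t s t'} (D : Ty k Γ A B) → t ⟶ s → Γ ⊢ t ≈ s ∶ A → El D s t' → El D t t'
El-expand (Ty-sort p (_ , c) _) s e (d , R) =
  let e' = ≈-conv* e c in ≈-trans e' d , raise p (Ty-expand s (≃-one e') (lower p R))
El-expand (Ty-ne (_ , c) _ _ _ _) s e d = ≈-trans (≈-conv* e c) d
El-expand (Ty-Π {a} (_ , c) _ _ _ dom cod) s e (d , f) =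
  let e' = ≈-conv* e c in ≈-trans e' d , λ r x →
    El-expand (cod r x) (app⟶ (ren-⟶ s)) (≈-app′ (ren-≈ r e') (ArgRel-≈ˡ a (dom r) x)) (f r x)

El-expandʳ : ∀ {k Γ A B t s t'} (D : Ty k Γ A B) → t ⟶ s → Γ ⊢ t ≈ s ∶ A → El D t' s → El D t' t
El-expandʳ D s e x = El-symm D (El-expand D s e (El-symm D x))

-- The two neutrals need not share a head: at sorts and neutral types declarative equality suffices,
-- and at Π types applying them gives neutrals again. This relates variables to themselves and thus
-- starts the identity environment.
El-reflect : ∀ {k Γ A B n n'} (D : Ty k Γ A B) → Neutral n → Neutral n' →
  Γ ⊢ n ≈ n' ∶ A → El D n n'
El-reflect (Ty-sort p (_ , c) _) n n' d = let d' = ≈-conv* d c in d' ,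
  raise p (Ty-ne (ev-whnf (wh-ne n) , []) (ev-whnf (wh-ne n') , []) n n' (≃-one d'))
El-reflect (Ty-ne (_ , c) _ _ _ _) n n' d = ≈-conv* d c
El-reflect (Ty-Π {a} (_ , c) _ _ _ dom cod) n n' d = let d' = ≈-conv* d c in d' , λ r x →
  El-reflect (cod r x) (ne-app (ren-Neutral n)) (ne-app (ren-Neutral n'))
    (≈-app′ (ren-≈ r d') (ArgRel-≈ a (dom r) x))

-- The fundamental lemma

Rel : Ctx → Tm → Tm → Tm → Tm → Set
Rel Δ A B t t' = Σ ℕ λ k → Σ (Ty k Δ A B) λ D → El D t t'

-- At an irrelevant entry each image is typed at its own instance of `U` and nothing links the two.
-- This is enough because `SubRel-var` never lands on such an entry.
SubRel : Ctx → (ℕ → Tm) → (ℕ → Tm) → Ctx → Set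
SubRel Δ σ σ' ε = Wf Δ
SubRel Δ σ σ' (Γ ▸ rel ∶ U) = SubRel Δ (σ ∘ suc) (σ' ∘ suc) Γ ×
  Rel Δ (sub (σ ∘ suc) U) (sub (σ' ∘ suc) U) (σ zero) (σ' zero)
SubRel Δ σ σ' (Γ ▸ irr ∶ U) = SubRel Δ (σ ∘ suc) (σ' ∘ suc) Γ ×
  (Δ ⊕) ⊢ σ zero ≈ σ zero ∶ sub (σ ∘ suc) U × (Δ ⊕) ⊢ σ' zero ≈ σ' zero ∶ sub (σ' ∘ suc) U

SubRel-wf : ∀ {Δ σ σ'} Γ → SubRel Δ σ σ' Γ → Wf Δ
SubRel-wf ε s = s
SubRel-wf (Γ ▸ rel ∶ U) (s , _) = SubRel-wf Γ s
SubRel-wf (Γ ▸ irr ∶ U) (s , _) = SubRel-wf Γ s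

SubRel-sym : ∀ {Δ σ σ'} Γ → SubRel Δ σ σ' Γ → SubRel Δ σ' σ Γ
SubRel-sym ε s = s
SubRel-sym (Γ ▸ rel ∶ U) (s , k , D , x) =
  SubRel-sym Γ s , k , Ty-sym D , proj₁ (El-swap D) x
SubRel-sym (Γ ▸ irr ∶ U) (s , d , d') = SubRel-sym Γ s , d' , d

SubRel-reflˡ : ∀ {Δ σ σ'} Γ → SubRel Δ σ σ' Γ → SubRel Δ σ σ Γ
SubRel-reflˡ ε s = s
SubRel-reflˡ (Γ ▸ rel ∶ U) (s , k , D , x) = SubRel-reflˡ Γ s , k , D' , El-cast D D' (El-reflˡ D x)
  where D' = Ty-trans D (Ty-sym D)
SubRel-reflˡ (Γ ▸ irr ∶ U) (s , d , d') = SubRel-reflˡ Γ s , d , d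

SubRel-reflʳ : ∀ {Δ σ σ'} Γ → SubRel Δ σ σ' Γ → SubRel Δ σ' σ' Γ
SubRel-reflʳ Γ s = SubRel-reflˡ Γ (SubRel-sym Γ s)

SubRel-ren : ∀ {Θ Δ ρ σ σ'} Γ → Ren Θ ρ Δ → SubRel Δ σ σ' Γ →
  SubRel Θ (ren ρ ∘ σ) (ren ρ ∘ σ') Γ
SubRel-ren ε r s = wf r
SubRel-ren {Θ} (Γ ▸ rel ∶ U) r (s , k , D , x) = SubRel-ren Γ r s , k ,
  subst₂ (Ty k Θ) (ren-sub U) (ren-sub U) (Ty-ren r D) ,
  El-subst (ren-sub U) (ren-sub U) (Ty-ren r D) (El-ren r D x)
SubRel-ren {Θ} (Γ ▸ irr ∶ U) r (s , d , d') = SubRel-ren Γ r s ,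
  subst (λ U → (Θ ⊕) ⊢ _ ≈ _ ∶ U) (ren-sub U) (ren-≈ (Ren-⊕ r) d) ,
  subst (λ U → (Θ ⊕) ⊢ _ ≈ _ ∶ U) (ren-sub U) (ren-≈ (Ren-⊕ r) d')

SubRel-cons : ∀ {Δ σ σ' k u u'} Γ a {U} → SubRel Δ σ σ' Γ → (D : Ty k Δ (sub σ U) (sub σ' U)) →
  ArgRel a Δ (sub σ U) (El D) u u' → SubRel Δ (u ∙ σ) (u' ∙ σ') (Γ ▸ a ∶ U)
SubRel-cons Γ rel s D x = s , _ , D , x
SubRel-cons Γ irr s D (≈-irr d d') = s , d , ≈-conv* d' (≃-⊕ (Ty-≃ D))

SubRel-var : ∀ {Δ σ σ' Γ x T} → Γ ∋ x ∶ T → SubRel Δ σ σ' Γ →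
  Rel Δ (sub σ T) (sub σ' T) (σ x) (σ' x)
SubRel-var {Δ} {σ} {σ'} (here {T = T}) (_ , k , D , x) =
  k , subst₂ (Ty k Δ) (sym (sub-ren T)) (sym (sub-ren T)) D ,
  El-subst (sym (sub-ren T)) (sym (sub-ren T)) D x
SubRel-var {Δ} (there {a = rel} {T = T} v) (s , _) with SubRel-var v s
... | k , D , x = k , subst₂ (Ty k Δ) (sym (sub-ren T)) (sym (sub-ren T)) D ,
  El-subst (sym (sub-ren T)) (sym (sub-ren T)) D x
SubRel-var {Δ} (there {a = irr} {T = T} v) (s , _) with SubRel-var v s
... | k , D , x = k , subst₂ (Ty k Δ) (sym (sub-ren T)) (sym (sub-ren T)) D ,
  El-subst (sym (sub-ren T)) (sym (sub-ren T)) D x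

SubRel-left : ∀ {Δ σ σ'} Γ → SubRel Δ σ σ' Γ → Sub Δ σ Γ
SubRel-left ε s = record { wfˢ = s ; var≈ = λ () ; var≈⊕ = λ () }
SubRel-left (Γ ▸ rel ∶ U) (s , _ , D , x) = Sub-cons (SubRel-left Γ s) (≈-rel (≈-left (El-≈ D x)))
SubRel-left (Γ ▸ irr ∶ U) (s , d , _) = Sub-cons (SubRel-left Γ s) (≈-irr d d)

SubRel-SubEq : ∀ {Δ σ σ'} Γ → SubRel Δ σ σ' Γ → SubEq Δ σ σ' Γ
SubRel-SubEq Γ s .left = SubRel-left Γ s
SubRel-SubEq Γ s .right = SubRel-left Γ (SubRel-sym Γ s)
SubRel-SubEq Γ s .eq v with SubRel-var v s
... | _ , D , x = El-≈ D x

Rel-sort : ∀ {Δ j A B} → Rel Δ (sort j) (sort j) A B → Ty j Δ A B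
Rel-sort (_ , Ty-sort p (e , _) _ , _ , R) with Whnf-↘ wh-sort e
... | refl = lower p R
Rel-sort (_ , Ty-ne (e , _) _ n _ _ , _) = sort≢Neutral (ev-whnf wh-sort) e n
Rel-sort (_ , Ty-Π (e , _) _ _ _ _ _ , _) = sort≢Π (ev-whnf wh-sort) e

Rel-cast : ∀ {Δ A A' B C k t s t' s'} → Rel Δ A B t t' → A ≐ A' → t ≐ s → t' ≐ s' →
  (D : Ty k Δ A' C) → El D s s'
Rel-cast (_ , D , x) refl refl refl D' = El-cast D D' x

sort-Rel : ∀ {Δ j A B} → Δ ⊢ A ≈ B ∶ sort j → Ty j Δ A B → Rel Δ (sort j) (sort j) A B
sort-Rel d D = _ , Ty-sort <′-base (ev-whnf wh-sort , []) (ev-whnf wh-sort , []) , d , D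

β-sub : ∀ {Θ Δ Γ ρ σ a U t T u} → Ren Θ ρ Δ → Sub Δ σ Γ → (Γ ▸ a ∶ U) ⊢ t ≈ t ∶ T →
  Θ ⊢ u ≈ u ∶[ a ] ren ρ (sub σ U) →
  Θ ⊢ app a (ren ρ (sub σ (lam a U t))) u ≈ ren (liftRen ρ) (sub (liftSub σ) t) [ u ]
    ∶ ren (liftRen ρ) (sub (liftSub σ) T) [ u ]
β-sub r s dt du with ≈-wf dt
... | wf-▸ _ dU = ≈-β′ (ren-≈ (Ren-liftˡ r (sub-≈ (SubEq-refl s) dU))
                        (sub-≈ (SubEq-liftˡ (SubEq-refl s) dU) dt)) du

≈-arg-right : ∀ {Γ a u u' U} → Γ ⊢ u ≈ u' ∶[ a ] U → Γ ⊢ u' ≈ u' ∶[ a ] U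
≈-arg-right (≈-rel d)    = ≈-rel (≈-right d)
≈-arg-right (≈-irr _ d)  = ≈-irr d d

-- `⟦U⟧` relates the two domains, but extending the environment over `Γ ▸ a ∶ U` calls for `U` on
-- both sides, which `⟦U⟧ˡ` provides; the arguments move between the two because the left type is
-- the same.
module Π-Sub {Γ Δ σ σ' a i j} U U' T T' (s : SubRel Δ σ σ' Γ)
  (eU : Δ ⊢ sub σ U ≈ sub σ' U' ∶ sort i)
  (eT : (Δ ▸ a ∶ sub σ U) ⊢ sub (liftSub σ) T ≈ sub (liftSub σ') T' ∶ sort j)
  (⟦U⟧ˡ : ∀ {Θ τ τ'} → SubRel Θ τ τ' Γ → Ty i Θ (sub τ U) (sub τ' U))
  (⟦U⟧ : ∀ {Θ τ τ'} → SubRel Θ τ τ' Γ → Ty i Θ (sub τ U) (sub τ' U'))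
  (⟦T⟧ : ∀ {Θ τ τ'} → SubRel Θ τ τ' (Γ ▸ a ∶ U) → Ty j Θ (sub τ T) (sub τ' T')) where

  dom : ∀ {Θ ρ} → Ren Θ ρ Δ → Ty (i ⊔ j) Θ (ren ρ (sub σ U)) (ren ρ (sub σ' U'))
  dom r = subst₂ (Ty (i ⊔ j) _) (sym (ren-sub U)) (sym (ren-sub U'))
    (Ty-cumul (≤⇒≤′ (m≤m⊔n i j)) (⟦U⟧ (SubRel-ren Γ r s)))

  ext : ∀ {Θ ρ} (r : Ren Θ ρ Δ) {u u'} → ArgRel a Θ (ren ρ (sub σ U)) (El (dom r)) u u' →
    SubRel Θ (u ∙ (ren ρ ∘ σ)) (u' ∙ (ren ρ ∘ σ')) (Γ ▸ a ∶ U)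
  ext r x = SubRel-cons Γ a (SubRel-ren Γ r s) D
    (ArgRel-subst a (ren-sub U) (ArgRel-map a [] (λ y → El-cast _ D
      (El-subst⁻ (sym (ren-sub U)) (sym (ren-sub U')) _ y)) x))
    where D = ⟦U⟧ˡ (SubRel-ren Γ r s)

  cod : ∀ {Θ ρ} (r : Ren Θ ρ Δ) {u u'} → ArgRel a Θ (ren ρ (sub σ U)) (El (dom r)) u u' →
    Ty (i ⊔ j) Θ (ren (liftRen ρ) (sub (liftSub σ) T) [ u ])
      (ren (liftRen ρ) (sub (liftSub σ') T') [ u' ])
  cod r x = subst₂ (Ty (i ⊔ j) _) (sym (ren-lift-[] T)) (sym (ren-lift-[] T'))
    (Ty-cumul (≤⇒≤′ (m≤n⊔m i j)) (⟦T⟧ (ext r x)))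

  ty : Ty (i ⊔ j) Δ (sub σ (Π a U i j T)) (sub σ' (Π a U' i j T'))
  ty = Ty-Π (ev-whnf wh-Π , []) (ev-whnf wh-Π , []) eU eT dom cod

mutual
  fund : ∀ {Γ Δ σ σ' t t' T} → Γ ⊢ t ≈ t' ∶ T → SubRel Δ σ σ' Γ →
    Rel Δ (sub σ T) (sub σ' T) (sub σ t) (sub σ' t')
  fund {Γ} (≈-sort w) s = sort-Rel (≈-sort (SubRel-wf Γ s))
    (Ty-sort <′-base (ev-whnf wh-sort , []) (ev-whnf wh-sort , []))
  fund (≈-var w x) s = SubRel-var x s
  fund {Γ} d@(≈-Π {U = U} {U'} {T} {T'} dU dT _) s = sort-Rel (sub-≈ S d) (Π-Sub.ty U U' T T' s
      (sub-≈ S dU) (sub-≈ (SubEq-liftˡ S dU) dT) (fund-Tyˡ dU) (fund-Ty dU) (fund-Ty dT))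
    where S = SubRel-SubEq Γ s
  fund {Γ} d@(≈-lam {U = U} {T = T} {t} {t'} dU dT dt _ dt') s =
    _ , P.ty , sub-≈ S d , λ r x →
      let du = ArgRel-≈ _ (P.dom r) x
          -- The right abstraction carries the domain `U'`, so its β-step needs the argument at the
          -- instance of `U'`.
          du' = ≈-arg-conv* (≈-arg-right du) (≃-ren r (≃-one (sub-≈ S dU)))
          D = P.cod r x
      in El-expand D β⟶ (β-sub r (left S) (≈-left dt) (ArgRel-≈ˡ _ (P.dom r) x))
           (El-expandʳ D β⟶ (≈-conv* (β-sub r (right S) dt' du') (≃-sym (Ty-≃ D)))
             (Rel-cast (fund dt (P.ext r x)) (sym (ren-lift-[] T)) (sym (ren-lift-[] t))
               (sym (ren-lift-[] t')) D))
    where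
      S = SubRel-SubEq Γ s
      module P = Π-Sub U U T T s (sub-≈ S (≈-reflˡ dU)) (sub-≈ (SubEq-liftˡ S (≈-reflˡ dU)) dT)
        (fund-Tyˡ dU) (fund-Tyˡ dU) (fund-Ty dT)
  fund {Γ} {Δ} {σ} {σ'} (≈-app {a = a} {t} {t'} {u} {u'} {U} {T} dU dT dt du dTu) s =
    -- The Kripke clause is used at the identity renaming. It compares at `T [ u ]` against
    -- `T [ u' ]`, while the goal has `T [ u ]` on both sides; `D`, built from `dTu`, may replace it
    -- because only the left type matters to `El`.
    _ , D , Rel-cast (_ , P.cod r x , proj₂ (Rel-cast (fund dt s) refl refl refl P.ty) r x)
      (trans (cong (_[ sub σ u ]) (ren-lift-id (sub (liftSub σ) T))) (sym (sub-[] T)))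
      (cong (λ t → app a t (sub σ u)) (ren-id _)) (cong (λ t → app a t (sub σ' u')) (ren-id _)) D
    where
      S = SubRel-SubEq Γ s
      module P = Π-Sub U U T T s (sub-≈ S dU) (sub-≈ (SubEq-liftˡ S dU) dT)
        (fund-Tyˡ dU) (fund-Ty dU) (fund-Ty dT)
      D = fund-Tyˡ dTu s
      r = Ren-id (SubRel-wf Γ s)
      x : ArgRel a Δ (ren id (sub σ U)) (El (P.dom r)) (sub σ u) (sub σ' u')
      x = ArgRel-subst a (sym (ren-id _)) (ArgRel-map a [] (El-subst⁻ (ren-id _) (ren-id _) (P.dom r))
        (fund-arg du dU s (subst₂ (Ty _ Δ) (ren-id _) (ren-id _) (P.dom r))))
  fund {Γ} {Δ} {σ} d@(≈-β {a = a} {U} {t} {u = u} _ _ _ _ dtu) s with fund dtu s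
  ... | k , D , x = k , D ,
    El-expand D (subst (sub σ (app a (lam a U t) u) ⟶_) (sym (sub-[] t)) β⟶)
      (sub-≈ (SubEq-refl (SubRel-left Γ s)) d) x
  fund {Γ} {Δ} {σ} {σ'} d@(≈-η {a = a} {U} {T} {t = t} dU dT dt _) s =
    _ , P.ty , sub-≈ S d , λ {Θ} {ρ} r {u} {u'} x →
      El-expandʳ (P.cod r x)
        (subst (λ s → app a (ren ρ (sub σ' (lam a U (app a (wk t) (var zero))))) u' ⟶ app a s u')
          (e ρ u') β⟶)
        (≈-conv* (≈-app′ (ren-≈ r (≈-symm (sub-≈ (SubEq-refl (right S)) d)))
            (≈-arg-conv* (≈-arg-right (ArgRel-≈ a (P.dom r) x)) (Ty-≃ (P.dom r))))
          (≃-sym (Ty-≃ (P.cod r x))))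
        (proj₂ (Rel-cast (fund dt s) refl refl refl P.ty) r x)
    where
      S = SubRel-SubEq Γ s
      module P = Π-Sub U U T T s (sub-≈ S dU) (sub-≈ (SubEq-liftˡ S dU) dT)
        (fund-Tyˡ dU) (fund-Ty dU) (fund-Ty dT)
      e : ∀ ρ u → ren (liftRen ρ) (sub (liftSub σ') (wk t)) [ u ] ≐ ren ρ (sub σ' t)
      e ρ u = trans (cong (λ t → ren (liftRen ρ) t [ u ]) (sub-wk t))
        (trans (cong (_[ u ]) (ren-wk (sub σ' t))) (wk-[] (ren ρ (sub σ' t))))
  fund {Γ} (≈-sym dT d) s with fund d (SubRel-sym Γ s)
  ... | k , D , x = k , Ty-sym D , proj₁ (El-swap D) x
  fund {Γ} (≈-trans d d') s with fund d (SubRel-reflˡ Γ s) | fund d' s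
  ... | k , D , x | _ , D' , x' = k , Ty-trans D D' , El-trans D D' x x'
  -- The new type under `σ` is linked to itself under `σ'` through the old type under `σ`; the
  -- composite and `E'` share their right endpoint.
  fund {Γ} (≈-conv d e) s = _ , Ty-trans (Ty-sym E) E' ,
    El-irrʳ E' (Ty-trans (Ty-sym E) E') (Rel-cast (fund d s) refl refl refl E')
    where E = fund-Ty e (SubRel-reflˡ Γ s)
          E' = fund-Ty e s

  fund-Ty : ∀ {Γ Δ σ σ' A B k} → Γ ⊢ A ≈ B ∶ sort k → SubRel Δ σ σ' Γ → Ty k Δ (sub σ A) (sub σ' B)
  fund-Ty d s = Rel-sort (fund d s)

  -- Both instances of `A` are related to `B` under `σ'`, which gives reflexivity of `A` while
  -- recurring only on the given derivation.
  fund-Tyˡ : ∀ {Γ Δ σ σ' A B k} → Γ ⊢ A ≈ B ∶ sort k → SubRel Δ σ σ' Γ → Ty k Δ (sub σ A) (sub σ' A)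
  fund-Tyˡ {Γ} d s = Ty-trans (fund-Ty d s) (Ty-sym (fund-Ty d (SubRel-reflʳ Γ s)))

  fund-arg : ∀ {Γ Δ σ σ' a u u' U k k' C} → Γ ⊢ u ≈ u' ∶[ a ] U → Γ ⊢ U ≈ U ∶ sort k' →
    SubRel Δ σ σ' Γ → (D : Ty k Δ (sub σ U) C) → ArgRel a Δ (sub σ U) (El D) (sub σ u) (sub σ' u')
  fund-arg (≈-rel d) dU s D = Rel-cast (fund d s) refl refl refl D
  fund-arg {Γ} d@(≈-irr _ _) dU s D = sub-≈-arg (SubRel-SubEq Γ s) dU d

-- Injectivity, subject reduction and uniqueness of sorts

SubRel-id : ∀ {Γ} → Wf Γ → SubRel Γ var var Γ
SubRel-id wf-ε = wf-ε
SubRel-id (wf-▸ {Γ} {a} {U} w d) = SubRel-snoc a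
  where
    s : ∀ {a} → SubRel (Γ ▸ a ∶ U) (var ∘ suc) (var ∘ suc) Γ
    s = SubRel-ren Γ (Ren-wk d) (SubRel-id w)
    v : ∀ {Δ} → Wf Δ → Δ ∋ zero ∶ wk U → Δ ⊢ var zero ≈ var zero ∶ sub (var ∘ suc) U
    v w x = subst (λ U → _ ⊢ _ ≈ _ ∶ U) (ren-is-sub U) (≈-var w x)
    SubRel-snoc : ∀ a → SubRel (Γ ▸ a ∶ U) var var (Γ ▸ a ∶ U)
    SubRel-snoc rel = s , _ , D , El-reflect D ne-var ne-var (v (wf-▸ w d) here)
      where D = fund-Ty d s
    SubRel-snoc irr = s , v w⊕ here , v w⊕ here
      where w⊕ = wf-▸ (wf-⊕ w) (≈-⊕ d)

fund-id : ∀ {Γ A B k} → Γ ⊢ A ≈ B ∶ sort k → Ty k Γ A B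
fund-id {Γ} {A} {B} {k} d = subst₂ (Ty k Γ) (sub-var A) (sub-var B) (fund-Ty d (SubRel-id (≈-wf d)))

-- Here the mixed sorts of a chain disappear: each link enters the relation at its own level, and
-- `Ty-trans` composes across levels.
≃-Ty : ∀ {Γ A B k} → Γ ⊢ A ≈ A ∶ sort k → Γ ⊢ A ≃ B → ∃ λ k → Ty k Γ A B
≃-Ty d []            = _ , fund-id d
≃-Ty d ((_ , e) ◅ c) = _ , Ty-trans (fund-id e) (proj₂ (≃-Ty (≈-right e) c))

sort-inj : ∀ {Γ i j} → Wf Γ → Γ ⊢ sort i ≃ sort j → i ≐ j
sort-inj w c with ≃-Ty (≈-sort w) c
... | _ , Ty-sort _ (e , _) (e' , _) with Whnf-↘ wh-sort e | Whnf-↘ wh-sort e'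
...   | refl | refl = refl
sort-inj w c | _ , Ty-ne (e , _) _ n _ _ = sort≢Neutral (ev-whnf wh-sort) e n
sort-inj w c | _ , Ty-Π (e , _) _ _ _ _ _ = sort≢Π (ev-whnf wh-sort) e

-- A Π evaluates only to itself, so the derivation must be a `Ty-Π` about these very types, and the
-- stored declarative equalities are the conclusion. The annotations fix the sorts, which makes
-- injectivity available before uniqueness of sorts.
Π-inj : ∀ {Γ a U i j T a' U' i' j' T' k} → Γ ⊢ Π a U i j T ≈ Π a U i j T ∶ sort k →
  Γ ⊢ Π a U i j T ≃ Π a' U' i' j' T' →
  (Γ ⊢ U ≈ U' ∶ sort i) × ((Γ ▸ a ∶ U) ⊢ T ≈ T' ∶ sort j)
Π-inj d c with ≃-Ty d c
... | _ , Ty-Π (e , _) (e' , _) dU dT _ _ with Whnf-↘ wh-Π e | Whnf-↘ wh-Π e'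
...   | refl | refl = dU , dT
Π-inj d c | _ , Ty-ne (e , _) _ n _ _ = Π≢Neutral (ev-whnf wh-Π) e n
Π-inj d c | _ , Ty-sort _ (e , _) _ = sort≢Π e (ev-whnf wh-Π)

-- Inversion of typing up to chains of conversions

inv-sort : ∀ {Γ i S} → Γ ⊢ sort i ∶ S → Γ ⊢ sort (suc i) ≃ S
inv-sort (ty-sort _)        = []
inv-sort (ty-conv d (_ , e)) = inv-sort d ◅◅ ≃-one (to-eq e)

inv-Π : ∀ {Γ a U i j T S} → Γ ⊢ Π a U i j T ∶ S →
  (Γ ⊢ U ∶ sort i) × ((Γ ▸ a ∶ U) ⊢ T ∶ sort j) × (Γ ⊢ sort (i ⊔ j) ≃ S)
inv-Π (ty-Π dU dT) = dU , dT , []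
inv-Π (ty-conv d (_ , e)) with inv-Π d
... | dU , dT , c = dU , dT , c ◅◅ ≃-one (to-eq e)

inv-var : ∀ {Γ x S} → Γ ⊢ var x ∶ S → ∃ λ U → Γ ∋ x ∶ U × Γ ⊢ U ≃ S
inv-var (ty-var _ x) = _ , x , []
inv-var (ty-conv d (_ , e)) with inv-var d
... | _ , x , c = _ , x , c ◅◅ ≃-one (to-eq e)

record LamInv (Γ : Ctx) (a : Ann) (U t S : Tm) : Set where
  constructor lamInv
  field
    {T}   : Tm
    {i j} : ℕ
    body  : (Γ ▸ a ∶ U) ⊢ t ∶ T
    conv  : Γ ⊢ Π a U i j T ≃ S

inv-lam : ∀ {Γ a U t S} → Γ ⊢ lam a U t ∶ S → LamInv Γ a U t S
inv-lam (ty-lam d _) = lamInv d []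
inv-lam (ty-conv d (_ , e)) with inv-lam d
... | lamInv dt c = lamInv dt (c ◅◅ ≃-one (to-eq e))

record AppInv (Γ : Ctx) (a : Ann) (t u S : Tm) : Set where
  constructor appInv
  field
    {U T} : Tm
    {i j} : ℕ
    fun   : Γ ⊢ t ∶ Π a U i j T
    arg   : Γ ⊢ u ∶[ a ] U
    conv  : Γ ⊢ T [ u ] ≃ S

inv-app : ∀ {Γ a t u S} → Γ ⊢ app a t u ∶ S → AppInv Γ a t u S
inv-app (ty-app dt du) = appInv dt du []
inv-app (ty-conv d (_ , e)) with inv-app d
... | appInv dt du c = appInv dt du (c ◅◅ ≃-one (to-eq e))

mutual
  -- Equality with the result and preservation of typing are one statement, since the right endpoint
  -- of `≈` is well typed. At a β-step, injectivity reconciles the domain and codomain of the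
  -- abstraction with those of its given type.
  ↘-≈ : ∀ {Γ t a T} → Γ ⊢ t ∶ T → t ↘ a → Γ ⊢ t ≈ a ∶ T
  ↘-≈ d (ev-whnf _) = to-≈ d
  ↘-≈ d (ev-app e f) with inv-app d
  ... | appInv dt du c = let dt' = ↘-≈ dt e in
    ≈-conv* (≈-trans (≈-app′ dt' (to-arg du)) (·-≈ (fromʳ dt') du f)) c

  ·-≈ : ∀ {Γ b f u r U i j T} → Γ ⊢ f ∶ Π b U i j T → Γ ⊢ u ∶[ b ] U → f ·[ b ] u ↘ r →
    Γ ⊢ app b f u ≈ r ∶ T [ u ]
  ·-≈ df du (ap-ne _) = ≈-app′ (to-≈ df) (to-arg du)
  ·-≈ df du (ap-β e) with inv-lam df
  ... | lamInv dt c with Π-inj (proj₂ (≈-type (to-≈ df))) (≃-sym c)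
  ...   | dU , dT = let du' = to-arg du ; dt' = ≈-ctx (≈-symm dU) (to-≈ dt)
                        dβ = ≈-β′ (to-≈ dt) (≈-arg-conv du' dU) in
    ≈-conv (≈-trans dβ (↘-≈ (fromʳ dβ) e)) (≈-symm (≈-[] (≈-left dU) dT du'))

∋-unique : ∀ {Γ x A B} → Γ ∋ x ∶ A → Γ ∋ x ∶ B → A ≐ B
∋-unique here here           = refl
∋-unique (there x) (there y) = cong wk (∋-unique x y)

Neutral-unique : ∀ {Γ n A B} → Neutral n → Γ ⊢ n ∶ A → Γ ⊢ n ∶ B → Γ ⊢ A ≃ B
Neutral-unique ne-var d d' with inv-var d | inv-var d'
... | _ , x , c | _ , x' , c' with ∋-unique x x'
...   | refl = ≃-sym c ◅◅ c'
Neutral-unique (ne-app n) d d' with inv-app d | inv-app d'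
... | appInv dt du c | appInv dt' _ c'
  with Π-inj (proj₂ (≈-type (to-≈ dt))) (Neutral-unique n dt dt')
...   | dU , dT = ≃-sym c ◅◅ ≃-one (≈-[] (≈-left dU) dT (to-arg du)) ◅◅ c'

-- The logical relation supplies a whnf of `T` that is a sort, a Π or a neutral; subject reduction
-- moves both typings to it, and inversion there ties both sorts together.
sort-unique : ∀ {Γ T i j} → Γ ⊢ T ∶ sort i → Γ ⊢ T ∶ sort j → i ≐ j
sort-unique {Γ} {T} {i} {j} d d' = sort-inj w (from-whnf (fund-id (to-≈ d)))
  where
    w = ≈-wf (to-≈ d)
    from-whnf : ∀ {k} → Ty k Γ T T → Γ ⊢ sort i ≃ sort j
    from-whnf (Ty-sort _ (e , _) _) =
      ≃-sym (inv-sort (fromʳ (↘-≈ d e))) ◅◅ inv-sort (fromʳ (↘-≈ d' e))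
    from-whnf (Ty-ne (e , _) _ n _ _) = Neutral-unique n (fromʳ (↘-≈ d e)) (fromʳ (↘-≈ d' e))
    from-whnf (Ty-Π (e , _) _ _ _ _ _) =
      ≃-sym (proj₂ (proj₂ (inv-Π (fromʳ (↘-≈ d e))))) ◅◅ proj₂ (proj₂ (inv-Π (fromʳ (↘-≈ d' e))))

-- Adjacent links share a type, and the sort of a type is unique, so the sort of the first type
-- propagates along the whole chain.
≃-collapse : ∀ {Γ A B k} → Γ ⊢ A ≈ A ∶ sort k → Γ ⊢ A ≃ B → Γ ⊢ A ≈ B ∶ sort k
≃-collapse d [] = d
≃-collapse d ((_ , e) ◅ c) with sort-unique (fromˡ d) (fromˡ e)
... | refl = ≈-trans e (≃-collapse (≈-right e) c)

-- Soundness of the algorithm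

≈-app-sound : ∀ {Γ a t t' u u' U T T₁ T₂ S S' i j} → Γ ⊢ t ≈ t' ∶ Π a U i j T →
  (Γ ▸ a ∶ U) ⊢ T ≈ T₁ ∶ sort j → (Γ ▸ a ∶ U) ⊢ T ≈ T₂ ∶ sort j →
  Γ ⊢ T₁ [ u ] ≃ S → Γ ⊢ T₂ [ u' ] ≃ S' → Γ ⊢ u ≈ u' ∶[ a ] U →
  (Γ ⊢ app a t u ≈ app a t' u' ∶ T [ u ]) × (Γ ⊢ T [ u ] ≃ S) × (Γ ⊢ T [ u ] ≃ S')
≈-app-sound dt dT₁ dT₂ c c' du = let dU , _ = Π-parts (proj₂ (≈-type dt)) in
  ≈-app′ dt du ,
  ≃-one (≈-[] dU dT₁ (≈-arg-trans du (≈-arg-sym dU du))) ◅◅ c ,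
  ≃-one (≈-[] dU dT₂ du) ◅◅ c'

mutual
  ⇔ty-sound : ∀ {Δ T T' k} → Δ ⊢ T ∶ sort k → Δ ⊢ T' ∶ sort k → Δ ⊢ T ⇔ty T' →
    Δ ⊢ T ≈ T' ∶ sort k
  ⇔ty-sound d d' (ty-alg e e' q) = let r = ↘-≈ d e ; r' = ↘-≈ d' e' in
    ≈-trans r (≈-trans (↔ty-sound (fromʳ r) (fromʳ r') q) (≈-symm r'))

  ↔ty-sound : ∀ {Δ T T' k} → Δ ⊢ T ∶ sort k → Δ ⊢ T' ∶ sort k → Δ ⊢ T ↔ty T' →
    Δ ⊢ T ≈ T' ∶ sort k
  ↔ty-sound d d' tyw-sort = to-≈ d
  ↔ty-sound d d' (tyw-Π qU qT) with inv-Π d | inv-Π d'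
  ... | dU , dT , c | dU' , dT' , _ = let eU = ⇔ty-sound dU dU' qU in
    -- The right codomain is typed over `U'`, but the algorithm compares codomains over `U`; the
    -- domain equality just obtained moves it there.
    ≈-conv* (≈-Π′ eU (⇔ty-sound dT (fromˡ (≈-ctx (≈-symm eU) (to-≈ dT'))) qT)) c
  ↔ty-sound d d' (tyw-ne _ _ q) with ⇔ne-sound d d' q
  ... | e , c , _ = ≈-conv* e c

  -- The sides may have different types: the induction passes to the heads of two applications,
  -- whose function types are found by separate inversions. Tying the computed type to both of them
  -- is what lets `Π-inj` bring each argument to the computed domain.
  ⇔ne-sound : ∀ {Δ n n' T T' U} → Δ ⊢ n ∶ T → Δ ⊢ n' ∶ T' → Δ ⊢ n ⇔ne n' ∶ U →
    (Δ ⊢ n ≈ n' ∶ U) × (Δ ⊢ U ≃ T) × (Δ ⊢ U ≃ T')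
  ⇔ne-sound d d' (ne-var x) with inv-var d | inv-var d'
  ... | _ , y , c | _ , y' , c' with ∋-unique x y | ∋-unique x y'
  ...   | refl | refl = ≈-var (≈-wf (to-≈ d)) x , c , c'
  ⇔ne-sound d d' (ne-apprel q qu) with inv-app d | inv-app d'
  ... | appInv dt (ann-rel du) c | appInv dt' (ann-rel du') c' with ↔ne-sound dt dt' q
  ...   | e , p , p' with Π-inj (proj₂ (≈-type e)) p | Π-inj (proj₂ (≈-type e)) p'
  ...     | dU , dT | dU' , dT' = ≈-app-sound e dT dT' c c'
    (≈-rel (⇔tm-sound (fromˡ (≈-conv (to-≈ du) (≈-symm dU)))
      (fromˡ (≈-conv (to-≈ du') (≈-symm dU'))) qu))
  ⇔ne-sound d d' (ne-appirr q) with inv-app d | inv-app d'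
  ... | appInv dt (ann-irr du) c | appInv dt' (ann-irr du') c' with ↔ne-sound dt dt' q
  ...   | e , p , p' with Π-inj (proj₂ (≈-type e)) p | Π-inj (proj₂ (≈-type e)) p'
  ...     | dU , dT | dU' , dT' = ≈-app-sound e dT dT' c c'
    (≈-irr (≈-conv (to-≈ du) (≈-⊕ (≈-symm dU))) (≈-conv (to-≈ du') (≈-⊕ (≈-symm dU'))))

  ↔ne-sound : ∀ {Δ n n' T T' U} → Δ ⊢ n ∶ T → Δ ⊢ n' ∶ T' → Δ ⊢ n ↔ne n' ∶ U →
    (Δ ⊢ n ≈ n' ∶ U) × (Δ ⊢ U ≃ T) × (Δ ⊢ U ≃ T')
  ↔ne-sound d d' (new q e) with ⇔ne-sound d d' q
  ... | dn , c , c' = let r = ↘-≈ (fromˡ (proj₂ (≈-type dn))) e ; r' = ≃-one (≈-symm r) in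
    ≈-conv dn r , r' ◅◅ c , r' ◅◅ c'

  ⇔tm-sound : ∀ {Δ t t' T} → Δ ⊢ t ∶ T → Δ ⊢ t' ∶ T → Δ ⊢ t ⇔tm t' ∶ T → Δ ⊢ t ≈ t' ∶ T
  ⇔tm-sound d d' (tm-alg e q) = let r = ↘-≈ (fromˡ (proj₂ (≈-type (to-≈ d)))) e in
    ≈-conv (↔tm-sound (fromˡ (≈-conv (to-≈ d) r)) (fromˡ (≈-conv (to-≈ d') r)) q) (≈-symm r)

  ↔tm-sound : ∀ {Δ t t' T} → Δ ⊢ t ∶ T → Δ ⊢ t' ∶ T → Δ ⊢ t ↔tm t' ∶ T → Δ ⊢ t ≈ t' ∶ T
  ↔tm-sound d d' (tmw-Π q) =
    let dU , dT = Π-parts (proj₂ (≈-type (to-≈ d)))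
        e = ⇔tm-sound (fromˡ (≈-app-var0 (to-≈ d))) (fromˡ (≈-app-var0 (to-≈ d'))) q
    in ≈-trans (≈-η′ (to-≈ d)) (≈-trans (≈-lam′ dU dT e) (≈-symm (≈-η′ (to-≈ d'))))
  ↔tm-sound d d' (tmw-sort q) = ⇔ty-sound d d' q
  ↔tm-sound d d' (tmw-ne _ e e' _ _ q) with ↘-≈ d e | ↘-≈ d' e'
  ... | r | r' with ⇔ne-sound (fromʳ r) (fromʳ r') q
  ...   | dn , c , _ = ≈-trans r (≈-trans (≈-conv* dn c) (≈-symm r'))

theorem5p12 : (∀ {Δ t t' T} → Δ ⊢ t ∶ T → Δ ⊢ t' ∶ T → Δ ⊢ t ⇔tm t' ∶ T → Δ ⊢ t ≡ t' ∶ T)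
    × (∀ {Δ n n' T U} → Δ ⊢ n ∶ T → Δ ⊢ n' ∶ T → Δ ⊢ n ⇔ne n' ∶ U →
    (Δ ⊢ n ≡ n' ∶ U) × (Δ ⊢ U ≡ty T))
theorem5p12 = (λ d d' q → from-eq (⇔tm-sound d d' q)) , λ d d' q →
  let e , c , _ = ⇔ne-sound d d' q
      k , dU = ≈-type e
  in from-eq e , k , from-eq (≃-collapse dU c)
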